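{- Let $I$ be a set, let $\tau\colon \mathbb{R}^I\to\mathbb{R}$ be a function and let $p\in[1,+\infty)$. The following conditions are equivalent. (1) $\tau$ preserves $p$-integrability over every finite measure space. (2) $\tau$ is $\mathrm{Cyl}(\mathbb{R}^I)$-measurable and there exist a finite subset $J\subseteq I$ and nonnegative real numbers $(\lambda_j)_{j\in J}$ and $k$ such that, for every $v\in\mathbb{R}^I$, $|\tau(v)|\leq k+\sum_{j\in J}\lambda_j|v_j|$.
   Context: The set $I$ may have any cardinality. $\mathrm{Cyl}(\mathbb{R}^I)$ is the smallest $\sigma$-algebra on $\mathbb{R}^I$ making every projection $\pi_i\colon\mathbb{R}^I\to\mathbb{R}$ ($i\in I$) measurable; $\mathbb{R}$ always carries its Borel $\sigma$-algebra. A measure space $(\Omega,\mathcal{F},\mu)$ is finite if $\mu(\Omega)<\infty$. $\mathcal{L}^p(\mu)$ is the set of $\mathcal{F}$-measurable functions $f\colon\Omega\to\mathbb{R}$ with $\int_\Omega|f|^p\,d\mu<\infty$ (actual functions, not classes). For a family $(f_i)_{i\in I}$ of functions $\Omega\to\mathbb{R}$, $\tau((f_i)_{i\in I})\colon\Omega\to\mathbb{R}$ is the function $x\mapsto\tau((f_i(x))_{i\in I})$. $\tau$ preserves $p$-integrability over $(\Omega,\mathcal{F},\mu)$ if $\tau((f_i)_{i\in I})\in\mathcal{L}^p(\mu)$ for every family $(f_i)_{i\in I}$ of elements of $\mathcal{L}^p(\mu)$. -}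

module Defs where

open import Algebra.Bundles using (CommutativeRing; Semiring)
open import Axiom.ExcludedMiddle using (ExcludedMiddle)
open import Data.Empty using (⊥)
open import Data.Fin.Base using (Fin; toℕ)
open import Data.Nat.Base as ℕ using (ℕ)
open import Data.Product.Base using (∃; ∃-syntax; _×_; _,_; proj₁; proj₂)
open import Data.Sum.Base using (_⊎_; [_,_]′)
open import Data.Unit.Base using (⊤)
open import Data.Vec.Functional as Vector using (Vector)
open import Function.Base using (_∘_; const)
open import Level using (Level; 0ℓ; _⊔_; Lift) renaming (suc to lsuc)
open import Relation.Binary.Core using (Rel)
open import Relation.Binary.PropositionalEquality.Core using (_≡_; _≢_)
open import Relation.Binary.Structures using (IsTotalOrder)
open import Relation.Nullary.Decidable.Core using (yes; no; True)
open import Relation.Nullary.Negation.Core using (¬_)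
open import Relation.Unary using (Pred; _∈_; _≐_; _⊆_; ∅; U; ∁; ⋃; _⊢_; Satisfiable) renaming (_⊥_ to _Disjoint_)

UpperBound : ∀ {a ℓ r} {A : Set a} → Rel A r → Pred A ℓ → Pred A (a ⊔ ℓ ⊔ r)
UpperBound _≤_ S b = ∀ x → x ∈ S → x ≤ b

IsSupremum : ∀ {a ℓ r} {A : Set a} → Rel A r → Pred A ℓ → Pred A (a ⊔ ℓ ⊔ r)
IsSupremum _≤_ S s =
  UpperBound _≤_ S s × (∀ b → UpperBound _≤_ S b → s ≤ b)

-- The real numbers, given by their usual axiomatisation.  The equality is that
-- of a setoid, since Agda has no quotients by which a construction of ℝ could
-- be given a propositional one.
record CompleteOrderedField : Set₁ where
  infix 4 _≤_
  field
    commutativeRing : CommutativeRing 0ℓ 0ℓ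

  open CommutativeRing commutativeRing public renaming (Carrier to ℝ)

  field
    _≤_          : Rel ℝ 0ℓ
    isTotalOrder : IsTotalOrder _≈_ _≤_
    0≉1          : ¬ (0# ≈ 1#)
    inverse      : ∀ x → ¬ (x ≈ 0#) → ∃[ y ] x * y ≈ 1#
    +-monoˡ-≤    : ∀ z {x y} → x ≤ y → x + z ≤ y + z
    *-nonNeg     : ∀ {x y} → 0# ≤ x → 0# ≤ y → 0# ≤ x * y
    complete     : (S : Pred ℝ 0ℓ) → Satisfiable S → Satisfiable (UpperBound _≤_ S) →
                   ∃[ s ] IsSupremum _≤_ S s

  open IsTotalOrder isTotalOrder public using (total)

  infix 4 _<_
  _<_ : Rel ℝ 0ℓ
  x < y = x ≤ y × ¬ (x ≈ y)

  ∣_∣ : ℝ → ℝ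
  ∣ x ∣ = [ const x , const (- x) ]′ (total 0# x)

  open import Algebra.Definitions.RawSemiring
    (Semiring.rawSemiring semiring) public
    using (_^_; sum) renaming (_×_ to _·_)

-- Subsets of X are predicates at level 0 whatever the level of X: by excluded
-- middle every predicate is equivalent to one of these, so they form the whole
-- power set.  They are compared by _≐_ (having the same elements).
Family : ∀ {ι} → Set ι → Set (lsuc (ι ⊔ lsuc 0ℓ))
Family {ι} X = Pred (Pred X 0ℓ) (ι ⊔ lsuc 0ℓ)

record IsSigmaAlgebra {ι} {X : Set ι} (𝓕 : Family X) : Set (ι ⊔ lsuc 0ℓ) where
  field
    resp       : ∀ {A B} → A ≐ B → A ∈ 𝓕 → B ∈ 𝓕
    whole      : U ∈ 𝓕
    complement : ∀ {A} → A ∈ 𝓕 → ∁ A ∈ 𝓕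
    union      : (A : ℕ → Pred X 0ℓ) → (∀ n → A n ∈ 𝓕) → ⋃ ℕ A ∈ 𝓕

data σ⟨_⟩ {ι} {X : Set ι} (G : Family X) : Family X where
  generator  : ∀ {A} → A ∈ G → A ∈ σ⟨ G ⟩
  resp       : ∀ {A B} → A ≐ B → A ∈ σ⟨ G ⟩ → B ∈ σ⟨ G ⟩
  whole      : U ∈ σ⟨ G ⟩
  complement : ∀ {A} → A ∈ σ⟨ G ⟩ → ∁ A ∈ σ⟨ G ⟩
  union      : (A : ℕ → Pred X 0ℓ) → (∀ n → A n ∈ σ⟨ G ⟩) → ⋃ ℕ A ∈ σ⟨ G ⟩

σ-isSigmaAlgebra : ∀ {ι} {X : Set ι} (G : Family X) → IsSigmaAlgebra σ⟨ G ⟩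
σ-isSigmaAlgebra G = record
  { resp = resp ; whole = whole ; complement = complement ; union = union }

σ-smallest : ∀ {ι} {X : Set ι} {G 𝓕 : Family X} → IsSigmaAlgebra 𝓕 → G ⊆ 𝓕 → σ⟨ G ⟩ ⊆ 𝓕
σ-smallest h G⊆𝓕 (generator A∈G)  = G⊆𝓕 A∈G
σ-smallest h G⊆𝓕 (resp A≐B A∈σ)   = IsSigmaAlgebra.resp h A≐B (σ-smallest h G⊆𝓕 A∈σ)
σ-smallest h G⊆𝓕 whole            = IsSigmaAlgebra.whole h
σ-smallest h G⊆𝓕 (complement A∈σ) = IsSigmaAlgebra.complement h (σ-smallest h G⊆𝓕 A∈σ)
σ-smallest h G⊆𝓕 (union A A∈σ)    = IsSigmaAlgebra.union h A (λ n → σ-smallest h G⊆𝓕 (A∈σ n))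

-- Excluded middle for all types, those of the form ∃ included, also supplies
-- choice: from ∀ x → ¬ ¬ (∃ y …) it yields a function choosing y.
module Analysis (em : ∀ {ℓ} → ExcludedMiddle ℓ) (R : CompleteOrderedField) where

  open CompleteOrderedField R

  -- The same subset, moved to level 0.
  lower : ∀ {ℓ} {X : Set} → Pred X ℓ → Pred X 0ℓ
  lower S x = True (em {P = x ∈ S})

  -- The least upper bound of a nonempty set that is bounded above, and 0
  -- otherwise.
  sup : ∀ {ℓ} → Pred ℝ ℓ → ℝ
  sup S with em {P = Satisfiable (lower S) × Satisfiable (UpperBound _≤_ (lower S))}
  ... | yes (nonempty , bounded) = proj₁ (complete (lower S) nonempty bounded)
  ... | no _                     = 0#

  -- root n x = x^(1/n) for x ≥ 0 and n ≥ 1.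
  root : ℕ → ℝ → ℝ
  root n x = sup λ y → 0# ≤ y × y ^ n ≤ x

  -- x^p for x ≥ 0 and p > 0, as the supremum of the powers x^(m/n) over those
  -- rationals m/n ≥ 0 with m/n ≤ p if x ≥ 1, and with m/n ≥ p if x ≤ 1 (where
  -- the exponential with base x is decreasing).
  infixr 8 _^ʳ_
  _^ʳ_ : ℝ → ℝ → ℝ
  x ^ʳ p = sup λ y → ∃[ m ] ∃[ n ] (1 ℕ.≤ n) × (y ≈ root n (x ^ m)) ×
    ((1# ≤ x × m · 1# ≤ n · p) ⊎ (x ≤ 1# × n · p ≤ m · 1#))

  data ℝ∞ : Set where
    fin : ℝ → ℝ∞
    ∞   : ℝ∞

  infix 4 _≤∞_
  _≤∞_ : Rel ℝ∞ 0ℓ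
  fin x ≤∞ fin y = x ≤ y
  _     ≤∞ ∞     = ⊤
  ∞     ≤∞ fin _ = ⊥

  infixl 6 _+∞_
  _+∞_ : ℝ∞ → ℝ∞ → ℝ∞
  fin x +∞ fin y = fin (x + y)
  fin _ +∞ ∞     = ∞
  ∞     +∞ _     = ∞

  -- Used only for a ≥ 0, with 0 · ∞ = 0.
  infixl 7 _*∞_
  _*∞_ : ℝ → ℝ∞ → ℝ∞
  a *∞ fin x = fin (a * x)
  a *∞ ∞ with em {P = a ≈ 0#}
  ... | yes _ = fin 0#
  ... | no  _ = ∞

  sum∞ : ∀ {n} → Vector ℝ∞ n → ℝ∞
  sum∞ = Vector.foldr _+∞_ (fin 0#)

  IsFinite : Pred ℝ∞ 0ℓ
  IsFinite (fin _) = ⊤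
  IsFinite ∞       = ⊥

  -- The supremum in [0,∞] of a set containing some fin x.
  sup∞ : ∀ {ℓ} → Pred ℝ∞ ℓ → ℝ∞
  sup∞ S with em {P = ∃[ b ] UpperBound _≤∞_ S (fin b)}
  ... | yes _ = fin (sup (fin ⊢ S))
  ... | no  _ = ∞

  IsOpen : Pred (Pred ℝ 0ℓ) 0ℓ
  IsOpen A = ∀ x → x ∈ A → ∃[ ε ] 0# < ε × (∀ y → ∣ y - x ∣ < ε → y ∈ A)

  Borel : Family ℝ
  Borel = σ⟨ (λ A → Lift (lsuc 0ℓ) (IsOpen A)) ⟩

  Measurable : ∀ {ι} {X : Set ι} → Family X → Pred (X → ℝ) (ι ⊔ lsuc 0ℓ)
  Measurable 𝓕 f = ∀ B → B ∈ Borel → (f ⊢ B) ∈ 𝓕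

  Cyl : ∀ {ι} (I : Set ι) → Family (I → ℝ)
  Cyl I = σ⟨ (λ A → ∃[ i ] ∃[ B ] B ∈ Borel × A ≐ ((λ (v : I → ℝ) → v i) ⊢ B)) ⟩

  record MeasureSpace (ι : Level) : Set (lsuc (ι ⊔ lsuc 0ℓ)) where
    field
      Ω              : Set ι
      𝓕              : Family Ω
      isSigmaAlgebra : IsSigmaAlgebra 𝓕
      -- Only the values of μ on members of 𝓕 are constrained or used.
      μ              : Pred Ω 0ℓ → ℝ∞
      μ-cong         : ∀ {A B} → A ∈ 𝓕 → A ≐ B → μ A ≤∞ μ B
      μ-nonNeg       : ∀ {A} → A ∈ 𝓕 → fin 0# ≤∞ μ A
      μ-∅            : μ ∅ ≤∞ fin 0#
      μ-union        : (A : ℕ → Pred Ω 0ℓ) → (∀ n → A n ∈ 𝓕) →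
                       (∀ {m n} → m ≢ n → A m Disjoint A n) →
                       IsSupremum _≤∞_
                         (λ s → ∃[ n ] s ≡ sum∞ {n} (λ k → μ (A (toℕ k))))
                         (μ (⋃ ℕ A))

  FiniteMeasure : ∀ {ι} → Pred (MeasureSpace ι) 0ℓ
  FiniteMeasure M = IsFinite (μ U) where open MeasureSpace M

  module _ {ι} (M : MeasureSpace ι) where
    open MeasureSpace M

    -- The simple function taking the value coeff i on piece i, and 0 elsewhere.
    record SimpleFunction : Set (ι ⊔ lsuc 0ℓ) where
      field
        size     : ℕ
        coeff    : Fin size → ℝ
        nonNeg   : ∀ i → 0# ≤ coeff i
        piece    : Fin size → Pred Ω 0ℓ
        piece∈𝓕  : ∀ i → piece i ∈ 𝓕
        disjoint : ∀ {i j} → i ≢ j → piece i Disjoint piece j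

      integral : ℝ∞
      integral = sum∞ (λ i → coeff i *∞ μ (piece i))

    -- For f ≥ 0 this says that the simple function is pointwise at most f.
    _Below_ : SimpleFunction → (Ω → ℝ) → Set ι
    s Below f = ∀ i x → x ∈ piece i → coeff i ≤ f x
      where open SimpleFunction s

    -- The Lebesgue integral of a measurable f ≥ 0.
    ∫ : (Ω → ℝ) → ℝ∞
    ∫ f = sup∞ λ y → ∃[ s ] s Below f × y ≡ SimpleFunction.integral s

    𝓛 : ℝ → Pred (Ω → ℝ) (ι ⊔ lsuc 0ℓ)
    𝓛 p f = Measurable 𝓕 f × IsFinite (∫ (λ x → ∣ f x ∣ ^ʳ p))

    PreservesIntegrability : {I : Set ι} → ℝ → ((I → ℝ) → ℝ) → Set (ι ⊔ lsuc 0ℓ)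
    PreservesIntegrability {I} p τ =
      (f : I → Ω → ℝ) → (∀ i → f i ∈ 𝓛 p) → (λ x → τ (λ i → f i x)) ∈ 𝓛 p

-- (2) ⇒ (1): |τ(f)| ≤ Λ max(1, |f_j|), and (Λy)ᵖ ≤ C yᵖ for y ≥ 1.  A simple
-- function below |τ(f)|ᵖ is cut along the sets where one of the functions
-- |f_j|ᵖ, or the constant 1, dominates it up to the factor C; each part is controlled by
-- the integral of that function.
--
-- (1) ⇒ (2): Measurability of τ is preservation over ℝᴵ with the cylinder
-- σ-algebra and the zero measure, applied to the projections.  Hence the sets
-- {|τ| > k} depend on countably many coordinates i₁, i₂, … only.  If no affine
-- bound exists, choose vₙ with |τ(vₙ)| ≥ 2ⁿ⁺¹ Sₙ, where Sₙ ≥ 1 dominates the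
-- coordinates i₁, …, iₙ of vₙ, and let vₙ vanish outside {i₁, i₂, …}.  On ℕ
-- with weights 2⁻ⁿ⁻¹ / Sₙᵖ every coordinate of v is then p-integrable, while
-- each point contributes at least 1 to the integral of |τ(v)|ᵖ.
module Submission where

open import Defs
import Algebra.Solver.Ring.NaturalCoefficients.Default
open import Axiom.ExcludedMiddle using (ExcludedMiddle)
open import Data.Empty using (⊥-elim)
open import Data.Fin.Base using (Fin; zero; suc; toℕ; fromℕ<; inject≤)
open import Data.Fin.Properties
  using (¬Fin0; suc-injective; toℕ-injective; toℕ-fromℕ<; toℕ-inject≤)
open import Data.List.Base using (List; []; _∷_; concatMap; upTo)
open import Data.List.Membership.Propositional using (lose) renaming (_∈_ to _∈ₗ_)
open import Data.List.Membership.Propositional.Properties using (∈-concatMap⁺; ∈-upTo⁺)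
open import Data.List.Relation.Unary.Any using (here; there)
open import Data.Nat.Base as ℕ using (ℕ; zero; suc; s≤s; z≤n)
import Data.Nat.Properties as ℕ
open import Data.Product.Base using (Σ-syntax; ∃; ∃-syntax; _×_; _,_; proj₁; proj₂)
open import Data.Sum.Base using (inj₁; inj₂)
open import Data.Unit.Base using (⊤)
open import Function.Base using (_∘_; id)
open import Function.Bundles using (_⇔_; mk⇔)
open import Function.Definitions using (Congruent; Injective)
open import Level using (Level; Lift; 0ℓ; lift)
open import Relation.Binary.Bundles using (Poset)
open import Relation.Binary.PropositionalEquality.Core as ≡ using (_≡_; _≢_)
open import Relation.Binary.Structures using (IsTotalOrder)
open import Relation.Nullary.Decidable.Core using (yes; no; toWitness; fromWitness; decidable-stable)
open import Relation.Nullary.Negation.Core using (¬_)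
open import Relation.Unary using (Pred; _∈_; _⊆_; _∩_; ∅; U; ∁; ⋃; _⊢_) renaming (_⊥_ to _Disjoint_)

-- The integral is a supremum over simple functions, and its additivity is never established. The
-- sum in the affine bound is therefore replaced by its largest term before anything is integrated:
-- being dominated at each point by one function from a finite list is a condition along which a
-- simple function can be cut. The constant 1 in that list keeps the dominating value at least 1,
-- where xᵖ is a supremum of powers x^(m/n) with m/n ≤ p. In the other direction the obstacle is an
-- uncountable I. Every coordinate of the sequence vₙ has to become p-integrable, but the failure of
-- an affine bound controls only finitely many coordinates of vₙ at a time. Once vₙ vanishes outside
-- a countable set C, every coordinate is controlled from some n on, and its finitely many earlier
-- terms only add a constant. To keep |τ(vₙ)| large, C must determine level sets of |τ|; natural
-- thresholds k make these countably many. The price is rounding a real bound up to a natural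
-- number, paid for by asking for (1 + Λ)Sₙ instead of ΛSₙ.

enumerate : (em : ∀ {ℓ} → ExcludedMiddle ℓ) → ∀ {a} {A : Set a} (xs : List A) →
  ∃[ n ] Σ[ J ∈ (Fin n → A) ] Injective _≡_ _≡_ J × (∀ x → x ∈ₗ xs → ∃[ j ] J j ≡ x)
enumerate em [] = 0 , (λ ()) , (λ { {()} }) , λ _ ()
enumerate em {A = A} (x ∷ xs) with enumerate em xs
... | n , J , J-injective , J-covers with em {P = ∃[ j ] J j ≡ x}
-- A repeated entry is dropped, because the affine bound is indexed by a finite subset of I and so
-- requires an injective `J`.
... | yes Jj≡x = n , J , J-injective , λ { _ (here ≡.refl) → Jj≡x ; y (there y∈xs) → J-covers y y∈xs }
... | no J≢x = suc n , x∷J , injective ,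
  λ { _ (here ≡.refl) → zero , ≡.refl ; y (there y∈xs) → let j , eq = J-covers y y∈xs in suc j , eq }
  where
  x∷J : Fin (suc n) → A
  x∷J zero    = x
  x∷J (suc j) = J j
  injective : Injective _≡_ _≡_ x∷J
  injective {zero}  {zero}  _  = ≡.refl
  injective {zero}  {suc j} eq = ⊥-elim (J≢x (j , ≡.sym eq))
  injective {suc i} {zero}  eq = ⊥-elim (J≢x (i , eq))
  injective {suc i} {suc j} eq = ≡.cong suc (J-injective eq)

-- Ordered field arithmetic, finite sums and partial sums

module OrderedField (R : CompleteOrderedField) where

  open CompleteOrderedField R hiding (zero)
  open IsTotalOrder isTotalOrder public
    using (antisym) renaming (refl to ≤-refl; reflexive to ≤-reflexive; trans to ≤-trans)
  open import Algebra.Properties.Ring ring public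
    using (-‿distribˡ-*; -‿involutive; -0#≈0#)
  open import Algebra.Properties.AbelianGroup +-abelianGroup public
    using (⁻¹-∙-comm; ⁻¹-anti-homo‿-; x∙y⁻¹≈ε⇒x≈y)
  open import Algebra.Properties.Semiring.Mult semiring public
    using (×-assocˡ)
  open import Algebra.Properties.Semiring.Exp semiring public using (^-assocʳ; ^-congˡ)
  open import Algebra.Properties.CommutativeSemiring.Exp commutativeSemiring public
    using (^-distrib-*)
  open import Algebra.Properties.Semiring.Sum semiring public
    using (sum-cong-≋; ∑-distrib-+; ∑-comm; *-distribˡ-sum; *-distribʳ-sum; sum-replicate-zero)

  poset : Poset 0ℓ 0ℓ 0ℓ
  poset = record { isPartialOrder = IsTotalOrder.isPartialOrder isTotalOrder }

  open import Relation.Binary.Reasoning.PartialOrder poset public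

  module Solver = Algebra.Solver.Ring.NaturalCoefficients.Default commutativeSemiring

  +-monoʳ-≤ : ∀ z {x y} → x ≤ y → z + x ≤ z + y
  +-monoʳ-≤ z {x} {y} x≤y = begin
    z + x  ≈⟨ +-comm z x ⟩
    x + z  ≤⟨ +-monoˡ-≤ z x≤y ⟩
    y + z  ≈⟨ +-comm y z ⟩
    z + y  ∎

  +-mono-≤ : ∀ {x y u v} → x ≤ y → u ≤ v → x + u ≤ y + v
  +-mono-≤ {x} {y} {u} {v} x≤y u≤v = ≤-trans (+-monoˡ-≤ u x≤y) (+-monoʳ-≤ y u≤v)

  +-nonNeg : ∀ {x y} → 0# ≤ x → 0# ≤ y → 0# ≤ x + y
  +-nonNeg 0≤x 0≤y = ≤-trans (≤-reflexive (sym (+-identityˡ 0#))) (+-mono-≤ 0≤x 0≤y)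

  x≤x+y : ∀ {x y} → 0# ≤ y → x ≤ x + y
  x≤x+y {x} 0≤y = ≤-trans (≤-reflexive (sym (+-identityʳ x))) (+-monoʳ-≤ x 0≤y)

  x≤y+x : ∀ {x y} → 0# ≤ y → x ≤ y + x
  x≤y+x {x} {y} 0≤y = ≤-trans (x≤x+y 0≤y) (≤-reflexive (+-comm x y))

  x-y+y≈x : ∀ x y → x - y + y ≈ x
  x-y+y≈x x y = trans (+-assoc x (- y) y) (trans (+-congˡ (-‿inverseˡ y)) (+-identityʳ x))

  x+y-y≈x : ∀ x y → x + y - y ≈ x
  x+y-y≈x x y = trans (+-assoc x y (- y)) (trans (+-congˡ (-‿inverseʳ y)) (+-identityʳ x))

  x+y≤z⇒x≤z-y : ∀ {x y z} → x + y ≤ z → x ≤ z - y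
  x+y≤z⇒x≤z-y {x} {y} {z} x+y≤z = begin
    x          ≈⟨ x+y-y≈x x y ⟨
    x + y - y  ≤⟨ +-monoˡ-≤ (- y) x+y≤z ⟩
    z - y      ∎

  x≤z-y⇒x+y≤z : ∀ {x y z} → x ≤ z - y → x + y ≤ z
  x≤z-y⇒x+y≤z {x} {y} {z} x≤z-y = begin
    x + y      ≤⟨ +-monoˡ-≤ y x≤z-y ⟩
    z - y + y  ≈⟨ x-y+y≈x z y ⟩
    z          ∎

  +-cancelʳ-≤ : ∀ z {x y} → x + z ≤ y + z → x ≤ y
  +-cancelʳ-≤ z {x} {y} x+z≤y+z = ≤-trans (x+y≤z⇒x≤z-y x+z≤y+z) (≤-reflexive (x+y-y≈x y z))

  x≤0⇒0≤-x : ∀ {x} → x ≤ 0# → 0# ≤ - x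
  x≤0⇒0≤-x {x} x≤0 = begin
    0#      ≈⟨ -‿inverseʳ x ⟨
    x - x   ≤⟨ +-monoˡ-≤ (- x) x≤0 ⟩
    0# - x  ≈⟨ +-identityˡ (- x) ⟩
    - x     ∎

  *-monoˡ-≤ : ∀ {z} → 0# ≤ z → ∀ {x y} → x ≤ y → z * x ≤ z * y
  *-monoˡ-≤ {z} 0≤z {x} {y} x≤y = begin
    z * x                ≤⟨ x≤y+x (*-nonNeg 0≤z 0≤y-x) ⟩
    z * (y - x) + z * x  ≈⟨ distribˡ z (y - x) x ⟨
    z * (y - x + x)      ≈⟨ *-congˡ (x-y+y≈x y x) ⟩
    z * y                ∎
    where
    0≤y-x : 0# ≤ y - x
    0≤y-x = x+y≤z⇒x≤z-y (≤-trans (≤-reflexive (+-identityˡ x)) x≤y)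

  *-monoʳ-≤ : ∀ {z} → 0# ≤ z → ∀ {x y} → x ≤ y → x * z ≤ y * z
  *-monoʳ-≤ {z} 0≤z {x} {y} x≤y = begin
    x * z  ≈⟨ *-comm x z ⟩
    z * x  ≤⟨ *-monoˡ-≤ 0≤z x≤y ⟩
    z * y  ≈⟨ *-comm z y ⟩
    y * z  ∎

  *-mono-≤ : ∀ {x y u v} → 0# ≤ y → 0# ≤ u → x ≤ y → u ≤ v → x * u ≤ y * v
  *-mono-≤ 0≤y 0≤u x≤y u≤v = ≤-trans (*-monoʳ-≤ 0≤u x≤y) (*-monoˡ-≤ 0≤y u≤v)

  0≤1 : 0# ≤ 1#
  0≤1 with total 0# 1#
  ... | inj₁ 0≤1 = 0≤1
  ... | inj₂ 1≤0 = begin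
    0#             ≤⟨ *-nonNeg (x≤0⇒0≤-x 1≤0) (x≤0⇒0≤-x 1≤0) ⟩
    - 1# * - 1#    ≈⟨ -‿distribˡ-* 1# (- 1#) ⟨
    - (1# * - 1#)  ≈⟨ -‿cong (*-identityˡ (- 1#)) ⟩
    - - 1#         ≈⟨ -‿involutive 1# ⟩
    1#             ∎

  1≤⇒0≤ : ∀ {x} → 1# ≤ x → 0# ≤ x
  1≤⇒0≤ = ≤-trans 0≤1

  1≰0 : ¬ (1# ≤ 0#)
  1≰0 1≤0 = 0≉1 (antisym 0≤1 1≤0)

  1≤⇒≉0 : ∀ {x} → 1# ≤ x → ¬ (x ≈ 0#)
  1≤⇒≉0 1≤x x≈0 = 1≰0 (≤-trans 1≤x (≤-reflexive x≈0))

  ≰⇒≥ : ∀ {x y} → ¬ (x ≤ y) → y ≤ x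
  ≰⇒≥ {x} {y} x≰y with total x y
  ... | inj₁ x≤y = ⊥-elim (x≰y x≤y)
  ... | inj₂ y≤x = y≤x

  ≰⇒> : ∀ {x y} → ¬ (x ≤ y) → y < x
  ≰⇒> x≰y = ≰⇒≥ x≰y , λ y≈x → x≰y (≤-reflexive (sym y≈x))

  <⇒≱ : ∀ {x y} → x < y → ¬ (y ≤ x)
  <⇒≱ (x≤y , x≉y) y≤x = x≉y (antisym x≤y y≤x)

  nonNegInverse : ∀ {x} → 0# ≤ x → ¬ (x ≈ 0#) → ∃[ y ] 0# ≤ y × x * y ≈ 1#
  nonNegInverse {x} 0≤x x≉0 with inverse x x≉0
  ... | y , xy≈1 with total 0# y
  ... | inj₁ 0≤y = y , 0≤y , xy≈1
  ... | inj₂ y≤0 = ⊥-elim (1≰0 (begin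
    1#      ≈⟨ xy≈1 ⟨
    x * y   ≤⟨ *-monoˡ-≤ 0≤x y≤0 ⟩
    x * 0#  ≈⟨ zeroʳ x ⟩
    0#      ∎))

  *-cancelˡ-≈ : ∀ {c d} → c * d ≈ 1# → ∀ x → c * (d * x) ≈ x
  *-cancelˡ-≈ {c} {d} cd≈1 x = trans (sym (*-assoc c d x)) (trans (*-congʳ cd≈1) (*-identityˡ x))

  c*x≤y⇒x≤d*y : ∀ {c d x y} → 0# ≤ d → c * d ≈ 1# → c * x ≤ y → x ≤ d * y
  c*x≤y⇒x≤d*y {c} {d} {x} {y} 0≤d cd≈1 cx≤y = begin
    x            ≈⟨ *-cancelˡ-≈ (trans (*-comm d c) cd≈1) x ⟨
    d * (c * x)  ≤⟨ *-monoˡ-≤ 0≤d cx≤y ⟩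
    d * y        ∎

  x≤d*y⇒c*x≤y : ∀ {c d x y} → 0# ≤ c → c * d ≈ 1# → x ≤ d * y → c * x ≤ y
  x≤d*y⇒c*x≤y {c} {d} {x} {y} 0≤c cd≈1 x≤dy = begin
    c * x        ≤⟨ *-monoˡ-≤ 0≤c x≤dy ⟩
    c * (d * y)  ≈⟨ *-cancelˡ-≈ cd≈1 y ⟩
    y            ∎

  1≤* : ∀ {x y} → 1# ≤ x → 1# ≤ y → 1# ≤ x * y
  1≤* {x} {y} 1≤x 1≤y = begin
    1#       ≈⟨ *-identityˡ 1# ⟨
    1# * 1#  ≤⟨ *-mono-≤ (1≤⇒0≤ 1≤x) 0≤1 1≤x 1≤y ⟩
    x * y    ∎

  y≤x*y : ∀ {x y} → 1# ≤ x → 0# ≤ y → y ≤ x * y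
  y≤x*y {x} {y} 1≤x 0≤y = ≤-trans (≤-reflexive (sym (*-identityˡ y))) (*-monoʳ-≤ 0≤y 1≤x)

  x≤x*y : ∀ {x y} → 0# ≤ x → 1# ≤ y → x ≤ x * y
  x≤x*y {x} {y} 0≤x 1≤y = ≤-trans (≤-reflexive (sym (*-identityʳ x))) (*-monoˡ-≤ 0≤x 1≤y)

  ·1-nonNeg : ∀ n → 0# ≤ n · 1#
  ·1-nonNeg zero    = ≤-refl
  ·1-nonNeg (suc n) = +-nonNeg 0≤1 (·1-nonNeg n)

  ·-monoʳ-≤ : ∀ n {x y} → x ≤ y → n · x ≤ n · y
  ·-monoʳ-≤ zero    x≤y = ≤-refl
  ·-monoʳ-≤ (suc n) x≤y = +-mono-≤ x≤y (·-monoʳ-≤ n x≤y)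

  ·1-cancel-≤ : ∀ m n → m · 1# ≤ n · 1# → m ℕ.≤ n
  ·1-cancel-≤ zero    n       _ = z≤n
  ·1-cancel-≤ (suc m) zero    h = ⊥-elim (1≰0 (≤-trans (x≤x+y (·1-nonNeg m)) h))
  ·1-cancel-≤ (suc m) (suc n) h = s≤s (·1-cancel-≤ m n (+-cancelʳ-≤ 1# (begin
    m · 1# + 1#  ≈⟨ +-comm (m · 1#) 1# ⟩
    1# + m · 1#  ≤⟨ h ⟩
    1# + n · 1#  ≈⟨ +-comm 1# (n · 1#) ⟩
    n · 1# + 1#  ∎)))

  ^-nonNeg : ∀ n {x} → 0# ≤ x → 0# ≤ x ^ n
  ^-nonNeg zero    0≤x = 0≤1
  ^-nonNeg (suc n) 0≤x = *-nonNeg 0≤x (^-nonNeg n 0≤x)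

  ^-mono-≤ : ∀ n {x y} → 0# ≤ x → x ≤ y → x ^ n ≤ y ^ n
  ^-mono-≤ zero    0≤x x≤y = ≤-refl
  ^-mono-≤ (suc n) 0≤x x≤y = *-mono-≤ (≤-trans 0≤x x≤y) (^-nonNeg n 0≤x) x≤y (^-mono-≤ n 0≤x x≤y)

  1≤^ : ∀ n {x} → 1# ≤ x → 1# ≤ x ^ n
  1≤^ zero    1≤x = ≤-refl
  1≤^ (suc n) 1≤x = 1≤* 1≤x (1≤^ n 1≤x)

  ^≤1 : ∀ n {x} → 0# ≤ x → x ≤ 1# → x ^ n ≤ 1#
  ^≤1 zero    0≤x x≤1 = ≤-refl
  ^≤1 (suc n) 0≤x x≤1 =
    ≤-trans (*-mono-≤ 0≤1 (^-nonNeg n 0≤x) x≤1 (^≤1 n 0≤x x≤1)) (≤-reflexive (*-identityˡ 1#))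

  ^-monoʳ-≤ : ∀ {x m n} → 1# ≤ x → m ℕ.≤ n → x ^ m ≤ x ^ n
  ^-monoʳ-≤ {n = n} 1≤x z≤n       = 1≤^ n 1≤x
  ^-monoʳ-≤         1≤x (s≤s m≤n) = *-monoˡ-≤ (1≤⇒0≤ 1≤x) (^-monoʳ-≤ 1≤x m≤n)

  -- If z ≤ w, then w zⁿ ≤ wⁿ⁺¹ ≤ zⁿ⁺¹, and the factor zⁿ ≥ 1 can be cancelled.
  ^-cancel-≤ : ∀ n {w z} → 1 ℕ.≤ n → 1# ≤ z → w ^ n ≤ z ^ n → w ≤ z
  ^-cancel-≤ (suc n) {w} {z} _ 1≤z wⁿ≤zⁿ with total w z
  ... | inj₁ w≤z = w≤z
  ... | inj₂ z≤w = begin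
    w                  ≈⟨ *-identityʳ w ⟨
    w * 1#             ≈⟨ *-congˡ zⁿd≈1 ⟨
    w * (z ^ n * d)    ≈⟨ *-assoc w (z ^ n) d ⟨
    w * z ^ n * d      ≤⟨ *-monoʳ-≤ 0≤d (≤-trans wzⁿ≤ wⁿ≤zⁿ) ⟩
    z * z ^ n * d      ≈⟨ *-assoc z (z ^ n) d ⟩
    z * (z ^ n * d)    ≈⟨ *-congˡ zⁿd≈1 ⟩
    z * 1#             ≈⟨ *-identityʳ z ⟩
    z                  ∎
    where
    inv = nonNegInverse (1≤⇒0≤ (1≤^ n 1≤z)) (1≤⇒≉0 (1≤^ n 1≤z))
    d = proj₁ inv
    0≤d = proj₁ (proj₂ inv)
    zⁿd≈1 = proj₂ (proj₂ inv)
    wzⁿ≤ : w * z ^ n ≤ w * w ^ n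
    wzⁿ≤ = *-monoˡ-≤ (≤-trans (1≤⇒0≤ 1≤z) z≤w) (^-mono-≤ n (1≤⇒0≤ 1≤z) z≤w)

  ∣x∣-nonNeg : ∀ x → 0# ≤ ∣ x ∣
  ∣x∣-nonNeg x with total 0# x
  ... | inj₁ 0≤x = 0≤x
  ... | inj₂ x≤0 = x≤0⇒0≤-x x≤0

  x≤∣x∣ : ∀ x → x ≤ ∣ x ∣
  x≤∣x∣ x with total 0# x
  ... | inj₁ 0≤x = ≤-refl
  ... | inj₂ x≤0 = ≤-trans x≤0 (x≤0⇒0≤-x x≤0)

  -x≤∣x∣ : ∀ x → - x ≤ ∣ x ∣
  -x≤∣x∣ x with total 0# x
  ... | inj₂ x≤0 = ≤-refl
  ... | inj₁ 0≤x = begin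
    - x       ≤⟨ x≤y+x 0≤x ⟩
    x - x     ≈⟨ -‿inverseʳ x ⟩
    0#        ≤⟨ 0≤x ⟩
    x         ∎

  ∣x∣≤ : ∀ {x y} → x ≤ y → - x ≤ y → ∣ x ∣ ≤ y
  ∣x∣≤ {x} x≤y -x≤y with total 0# x
  ... | inj₁ 0≤x = x≤y
  ... | inj₂ x≤0 = -x≤y

  ∣-∣-triangle : ∀ x y → ∣ y ∣ ≤ ∣ x ∣ + ∣ y - x ∣
  ∣-∣-triangle x y = ∣x∣≤
    (begin
      y                    ≈⟨ x-y+y≈x y x ⟨
      y - x + x            ≈⟨ +-comm (y - x) x ⟩
      x + (y - x)          ≤⟨ +-mono-≤ (x≤∣x∣ x) (x≤∣x∣ (y - x)) ⟩
      ∣ x ∣ + ∣ y - x ∣    ∎)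
    (begin
      - y                  ≈⟨ -‿cong (x-y+y≈x y x) ⟨
      - (y - x + x)        ≈⟨ -‿cong (+-comm (y - x) x) ⟩
      - (x + (y - x))      ≈⟨ ⁻¹-∙-comm x (y - x) ⟨
      - x + - (y - x)      ≤⟨ +-mono-≤ (-x≤∣x∣ x) (-x≤∣x∣ (y - x)) ⟩
      ∣ x ∣ + ∣ y - x ∣    ∎)

  ∣-∣-triangle′ : ∀ x y → ∣ x ∣ ≤ ∣ y ∣ + ∣ y - x ∣
  ∣-∣-triangle′ x y = ∣x∣≤
    (begin
      x                    ≈⟨ x-y+y≈x x y ⟨
      x - y + y            ≈⟨ +-comm (x - y) y ⟩
      y + (x - y)          ≈⟨ +-congˡ (⁻¹-anti-homo‿- y x) ⟨
      y + - (y - x)        ≤⟨ +-mono-≤ (x≤∣x∣ y) (-x≤∣x∣ (y - x)) ⟩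
      ∣ y ∣ + ∣ y - x ∣    ∎)
    (begin
      - x                  ≈⟨ x-y+y≈x (- x) (- y) ⟨
      - x - - y + - y      ≈⟨ +-comm (- x - - y) (- y) ⟩
      - y + (- x - - y)    ≈⟨ +-congˡ (+-congˡ (-‿involutive y)) ⟩
      - y + (- x + y)      ≈⟨ +-congˡ (+-comm (- x) y) ⟩
      - y + (y - x)        ≤⟨ +-mono-≤ (-x≤∣x∣ y) (x≤∣x∣ (y - x)) ⟩
      ∣ y ∣ + ∣ y - x ∣    ∎)

  sum-mono-≤ : ∀ {n} {a b : Fin n → ℝ} → (∀ i → a i ≤ b i) → sum a ≤ sum b
  sum-mono-≤ {zero}  a≤b = ≤-refl
  sum-mono-≤ {suc n} a≤b = +-mono-≤ (a≤b zero) (sum-mono-≤ (a≤b ∘ suc))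

  sum-nonNeg : ∀ {n} {a : Fin n → ℝ} → (∀ i → 0# ≤ a i) → 0# ≤ sum a
  sum-nonNeg {zero}  0≤a = ≤-refl
  sum-nonNeg {suc n} 0≤a = +-nonNeg (0≤a zero) (sum-nonNeg (0≤a ∘ suc))

  term≤sum : ∀ {n} {a : Fin n → ℝ} → (∀ i → 0# ≤ a i) → ∀ i → a i ≤ sum a
  term≤sum 0≤a zero    = x≤x+y (sum-nonNeg (0≤a ∘ suc))
  term≤sum 0≤a (suc i) = ≤-trans (term≤sum (0≤a ∘ suc) i) (x≤y+x (0≤a zero))

  n·1≤sum : ∀ {n} {a : Fin n → ℝ} → (∀ i → 1# ≤ a i) → n · 1# ≤ sum a
  n·1≤sum {zero}  1≤a = ≤-refl
  n·1≤sum {suc n} 1≤a = +-mono-≤ (1≤a zero) (n·1≤sum (1≤a ∘ suc))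

  maximum : ∀ {n} (a : Fin (suc n) → ℝ) → ∃[ j ] (∀ i → a i ≤ a j)
  maximum {zero}  a = zero , λ { zero → ≤-refl }
  maximum {suc n} a with maximum (a ∘ suc)
  ... | j , max with total (a zero) (a (suc j))
  ... | inj₁ a₀≤ = suc j , λ { zero → a₀≤ ; (suc i) → max i }
  ... | inj₂ a₀≥ = zero , λ { zero → ≤-refl ; (suc i) → ≤-trans (max i) a₀≥ }

  partialSum : (ℕ → ℝ) → ℕ → ℝ
  partialSum a zero    = 0#
  partialSum a (suc n) = partialSum a n + a n

  partialSum-mono-≤ : ∀ {a b} N → (∀ n → n ℕ.< N → a n ≤ b n) → partialSum a N ≤ partialSum b N
  partialSum-mono-≤ zero    a≤b = ≤-refl
  partialSum-mono-≤ (suc N) a≤b =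
    +-mono-≤ (partialSum-mono-≤ N (λ n n<N → a≤b n (ℕ.m<n⇒m<1+n n<N))) (a≤b N (ℕ.n<1+n N))

  partialSum-nonNeg : ∀ {a} → (∀ n → 0# ≤ a n) → ∀ N → 0# ≤ partialSum a N
  partialSum-nonNeg 0≤a zero    = ≤-refl
  partialSum-nonNeg 0≤a (suc N) = +-nonNeg (partialSum-nonNeg 0≤a N) (0≤a N)

  partialSum-mono-index : ∀ {a} → (∀ n → 0# ≤ a n) → ∀ {m n} → m ℕ.≤ n → partialSum a m ≤ partialSum a n
  partialSum-mono-index {a} 0≤a m≤n = go (ℕ.≤⇒≤′ m≤n)
    where
    go : ∀ {m n} → m ℕ.≤′ n → partialSum a m ≤ partialSum a n
    go (ℕ.≤′-reflexive ≡.refl) = ≤-refl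
    go (ℕ.≤′-step m≤n)         = ≤-trans (go m≤n) (x≤x+y (0≤a _))

  partialSum-zero : ∀ N → partialSum (λ _ → 0#) N ≈ 0#
  partialSum-zero zero    = refl
  partialSum-zero (suc N) = trans (+-identityʳ _) (partialSum-zero N)

  *-distribˡ-partialSum : ∀ c {a} N → c * partialSum a N ≈ partialSum (λ n → c * a n) N
  *-distribˡ-partialSum c     zero    = zeroʳ c
  *-distribˡ-partialSum c {a} (suc N) = trans (distribˡ c _ (a N)) (+-congʳ (*-distribˡ-partialSum c N))

  partialSum-sum : ∀ {k} (a : Fin k → ℕ → ℝ) N →
                   partialSum (λ n → sum (λ i → a i n)) N ≈ sum (λ i → partialSum (a i) N)
  partialSum-sum {k} a zero = sym (sum-replicate-zero k)
  partialSum-sum {k} a (suc N) =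
    trans (+-congʳ (partialSum-sum a N)) (sym (∑-distrib-+ (λ i → partialSum (a i) N) (λ i → a i N)))

  -- The terms before `N₀` cost only a constant. This is what makes a coordinate summable when its
  -- bound holds only from some index on.
  partialSum-eventually-≤ : ∀ {a b N₀} → (∀ n → 0# ≤ a n) → (∀ n → 0# ≤ b n) → (∀ n → N₀ ℕ.≤ n → a n ≤ b n) →
                            ∀ N → partialSum a N ≤ partialSum a N₀ + partialSum b N
  partialSum-eventually-≤ {a} {b} {N₀} 0≤a 0≤b a≤b zero = +-nonNeg (partialSum-nonNeg 0≤a N₀) ≤-refl
  partialSum-eventually-≤ {a} {b} {N₀} 0≤a 0≤b a≤b (suc N) with ℕ.≤-<-connex N₀ N
  ... | inj₁ N₀≤N = ≤-trans
    (+-mono-≤ (partialSum-eventually-≤ 0≤a 0≤b a≤b N) (a≤b N N₀≤N)) (≤-reflexive (+-assoc _ _ _))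
  ... | inj₂ N<N₀ = ≤-trans (partialSum-mono-index 0≤a N<N₀) (x≤x+y (partialSum-nonNeg 0≤b (suc N)))

-- Suprema and the Archimedean property

module Suprema (em : ∀ {ℓ} → ExcludedMiddle ℓ) (R : CompleteOrderedField) where

  open CompleteOrderedField R hiding (zero)
  open OrderedField R
  open Analysis em R

  ≤sup : ∀ {ℓ} (S : Pred ℝ ℓ) {b} → (∀ z → z ∈ S → z ≤ b) → ∀ z → z ∈ S → z ≤ sup S
  ≤sup S {b} S≤b z z∈S with em {P = (∃ (lower S)) × (∃ (UpperBound _≤_ (lower S)))}
  ... | yes (ne , bd) = proj₁ (proj₂ (complete (lower S) ne bd)) z (fromWitness z∈S)
  ... | no ¬sup = ⊥-elim (¬sup ((z , fromWitness z∈S) , b , λ y y∈S → S≤b y (toWitness y∈S)))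

  -- The hypothesis 0 ≤ b accounts for the junk value sup S = 0.
  sup≤ : ∀ {ℓ} (S : Pred ℝ ℓ) {b} → 0# ≤ b → (∀ z → z ∈ S → z ≤ b) → sup S ≤ b
  sup≤ S {b} 0≤b S≤b with em {P = (∃ (lower S)) × (∃ (UpperBound _≤_ (lower S)))}
  ... | yes (ne , bd) = proj₂ (proj₂ (complete (lower S) ne bd)) b (λ y y∈S → S≤b y (toWitness y∈S))
  ... | no _          = 0≤b

  0≤sup : ∀ {ℓ} (S : Pred ℝ ℓ) → (∀ z → z ∈ S → 0# ≤ z) → 0# ≤ sup S
  0≤sup S 0≤S with em {P = (∃ (lower S)) × (∃ (UpperBound _≤_ (lower S)))}
  ... | yes (ne@(z , z∈S) , bd) =
    ≤-trans (0≤S z (toWitness z∈S)) (proj₁ (proj₂ (complete (lower S) ne bd)) z z∈S)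
  ... | no _ = ≤-refl

  archimedean : ∀ x → ∃[ n ] x ≤ n · 1#
  archimedean x with em {P = ∃[ n ] x ≤ n · 1#}
  ... | yes p = p
  ... | no ¬p = ⊥-elim (1≰0 (+-cancelʳ-≤ s (begin
    1# + s  ≈⟨ +-comm 1# s ⟩
    s + 1#  ≤⟨ x≤z-y⇒x+y≤z (sup-least (s - 1#) s-1-bound) ⟩
    s       ≈⟨ +-identityˡ s ⟨
    0# + s  ∎)))
    where
    S : Pred ℝ 0ℓ
    S z = ∃[ n ] z ≈ n · 1#
    sup-S = complete S (0# , 0 , refl)
      (x , λ { z (n , z≈n) → ≤-trans (≤-reflexive z≈n) (≰⇒≥ (λ x≤n → ¬p (n , x≤n))) })
    s = proj₁ sup-S
    sup-upper = proj₁ (proj₂ sup-S)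
    sup-least = proj₂ (proj₂ sup-S)
    s-1-bound : ∀ z → z ∈ S → z ≤ s - 1#
    s-1-bound z (n , z≈n) = x+y≤z⇒x≤z-y (begin
      z + 1#       ≈⟨ +-comm z 1# ⟩
      1# + z       ≈⟨ +-congˡ z≈n ⟩
      1# + n · 1#  ≤⟨ sup-upper (1# + n · 1#) (suc n , refl) ⟩
      s            ∎)

  -- Needed because only level sets of |τ| at natural thresholds will be known to depend on
  -- countably many coordinates. The loss of at most 1 is absorbed in `spike`.
  ceiling : ∀ {x} → 0# ≤ x → ∃[ n ] x ≤ n · 1# × n · 1# ≤ 1# + x
  ceiling {x} 0≤x = descend (proj₁ (archimedean x)) (proj₂ (archimedean x))
    where
    descend : ∀ n → x ≤ n · 1# → ∃[ k ] x ≤ k · 1# × k · 1# ≤ 1# + x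
    descend zero    x≤n = 0 , x≤n , +-nonNeg 0≤1 0≤x
    descend (suc n) x≤n with total x (n · 1#)
    ... | inj₁ x≤n′ = descend n x≤n′
    ... | inj₂ n≤x  = suc n , x≤n , +-monoʳ-≤ 1# n≤x

  -- Real powers with exponent p ≥ 1

  module Power {p : ℝ} (1≤p : 1# ≤ p) where

    private
      -- A natural exponent at least p. For x ≥ 1 the power xᴺ bounds every x^(m/n) with m/n ≤ p, so
      -- the suprema defining xᵖ are genuine ones.
      N = proj₁ (archimedean p)

      exponent≤ : ∀ {m n} → m · 1# ≤ n · p → m ℕ.≤ N ℕ.* n
      exponent≤ {m} {n} m≤np = ·1-cancel-≤ m (N ℕ.* n) (begin
        m · 1#          ≤⟨ m≤np ⟩
        n · p           ≤⟨ ·-monoʳ-≤ n (proj₂ (archimedean p)) ⟩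
        n · (N · 1#)    ≈⟨ ×-assocˡ 1# n N ⟩
        (n ℕ.* N) · 1#  ≡⟨ ≡.cong (_· 1#) (ℕ.*-comm n N) ⟩
        (N ℕ.* n) · 1#  ∎)

      root-bound : ∀ {x w m n} → 1# ≤ x → 1 ℕ.≤ n → m · 1# ≤ n · p → w ^ n ≤ x ^ m → w ≤ x ^ N
      root-bound {x} {w} {m} {n} 1≤x 1≤n m≤np wⁿ≤xᵐ = ^-cancel-≤ n 1≤n (1≤^ N 1≤x) (begin
        w ^ n          ≤⟨ wⁿ≤xᵐ ⟩
        x ^ m          ≤⟨ ^-monoʳ-≤ 1≤x (exponent≤ {m} {n} m≤np) ⟩
        x ^ (N ℕ.* n)  ≈⟨ ^-assocʳ x N n ⟨
        (x ^ N) ^ n    ∎)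

      root≤1 : ∀ {x} m n → 0# ≤ x → x ≤ 1# → 1 ℕ.≤ n → root n (x ^ m) ≤ 1#
      root≤1 {x} m n 0≤x x≤1 1≤n = sup≤ _ 0≤1 (λ w (0≤w , wⁿ≤xᵐ) → ^-cancel-≤ n 1≤n ≤-refl (begin
        w ^ n   ≤⟨ wⁿ≤xᵐ ⟩
        x ^ m   ≤⟨ ^≤1 m 0≤x x≤1 ⟩
        1#      ≤⟨ 1≤^ n ≤-refl ⟩
        1# ^ n  ∎))

    -- Together with `^ʳ≤` this trades the two nested suprema for the single condition
    -- `w ^ n ≤ x ^ m`, so that later comparisons of real powers with bases at least 1 only involve
    -- natural exponents.
    ≤^ʳ : ∀ {x w} m n → 1# ≤ x → 1 ℕ.≤ n → m · 1# ≤ n · p → 0# ≤ w → w ^ n ≤ x ^ m → w ≤ x ^ʳ p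
    ≤^ʳ {x} {w} m n 1≤x 1≤n m≤np 0≤w wⁿ≤xᵐ = begin
      w               ≤⟨ ≤sup _ (λ z (_ , zⁿ≤xᵐ) → root-bound {m = m} 1≤x 1≤n m≤np zⁿ≤xᵐ) w (0≤w , wⁿ≤xᵐ) ⟩
      root n (x ^ m)  ≤⟨ ≤sup _ bound _ (m , n , 1≤n , refl , inj₁ (1≤x , m≤np)) ⟩
      x ^ʳ p          ∎
      where
      bound : ∀ y → _ → y ≤ x ^ N
      bound y (m , n , 1≤n , y≈ , inj₁ (_ , m≤np)) = ≤-trans (≤-reflexive y≈)
        (sup≤ _ (^-nonNeg N (1≤⇒0≤ 1≤x)) (λ z (_ , zⁿ≤xᵐ) → root-bound {m = m} 1≤x 1≤n m≤np zⁿ≤xᵐ))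
      -- This case arises when `x` equals 1: exponents above p then belong to the set as well, but
      -- their roots are at most 1.
      bound y (m , n , 1≤n , y≈ , inj₂ (x≤1 , _)) =
        ≤-trans (≤-reflexive y≈) (≤-trans (root≤1 m n (1≤⇒0≤ 1≤x) x≤1 1≤n) (1≤^ N 1≤x))

    ^ʳ≤ : ∀ {x b} → 1# ≤ x →
          (∀ m n w → 1 ℕ.≤ n → m · 1# ≤ n · p → 0# ≤ w → w ^ n ≤ x ^ m → w ≤ b) → x ^ʳ p ≤ b
    ^ʳ≤ {x} {b} 1≤x h = sup≤ _ (1≤⇒0≤ 1≤b) bound
      where
      -- `sup≤` asks for a nonnegative bound; the exponent 0/1 with `w` equal to 1 supplies it.
      1≤b : 1# ≤ b
      1≤b = h 0 1 1# (s≤s z≤n) (+-nonNeg (1≤⇒0≤ 1≤p) ≤-refl) 0≤1 (≤-reflexive (*-identityˡ 1#))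
      bound : ∀ y → _ → y ≤ b
      bound y (m , n , 1≤n , y≈ , inj₁ (_ , m≤np)) = ≤-trans (≤-reflexive y≈)
        (sup≤ _ (1≤⇒0≤ 1≤b) (λ w (0≤w , wⁿ≤xᵐ) → h m n w 1≤n m≤np 0≤w wⁿ≤xᵐ))
      bound y (m , n , 1≤n , y≈ , inj₂ (x≤1 , _)) =
        ≤-trans (≤-reflexive y≈) (≤-trans (root≤1 m n (1≤⇒0≤ 1≤x) x≤1 1≤n) 1≤b)

    ^ʳ≤1 : ∀ {x} → 0# ≤ x → x ≤ 1# → x ^ʳ p ≤ 1#
    ^ʳ≤1 0≤x x≤1 = sup≤ _ 0≤1 (λ y (m , n , 1≤n , y≈ , _) →
      ≤-trans (≤-reflexive y≈) (root≤1 m n 0≤x x≤1 1≤n))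

    ^ʳ-nonNeg : ∀ x → 0# ≤ x ^ʳ p
    ^ʳ-nonNeg x = 0≤sup _ λ { y (m , n , _ , y≈ , _) →
      ≤-trans (0≤sup (λ w → 0# ≤ w × w ^ n ≤ x ^ m) (λ _ → proj₁)) (≤-reflexive (sym y≈)) }

    1≤^ʳ : ∀ {x} → 1# ≤ x → 1# ≤ x ^ʳ p
    1≤^ʳ 1≤x = ≤^ʳ 0 1 1≤x (s≤s z≤n) (+-nonNeg (1≤⇒0≤ 1≤p) ≤-refl) 0≤1 (≤-reflexive (*-identityˡ 1#))

    ^ʳ-mono-≤ : ∀ {x y} → 0# ≤ x → 1# ≤ y → x ≤ y → x ^ʳ p ≤ y ^ʳ p
    ^ʳ-mono-≤ {x} {y} 0≤x 1≤y x≤y with total 1# x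
    ... | inj₂ x≤1 = ≤-trans (^ʳ≤1 0≤x x≤1) (1≤^ʳ 1≤y)
    ... | inj₁ 1≤x = ^ʳ≤ 1≤x λ m n w 1≤n m≤np 0≤w wⁿ≤xᵐ →
      ≤^ʳ m n 1≤y 1≤n m≤np 0≤w (≤-trans wⁿ≤xᵐ (^-mono-≤ m 0≤x x≤y))

    -- a · yᵖ ≤ (ay)ᵖ because a ≤ aᵖ: powers m/n ≥ 1 satisfy this already, and
    -- powers m/n < 1 are dominated by the first power.
    *^ʳ≤^ʳ : ∀ {a y} → 1# ≤ a → 1# ≤ y → a * y ^ʳ p ≤ (a * y) ^ʳ p
    *^ʳ≤^ʳ {a} {y} 1≤a 1≤y with nonNegInverse (1≤⇒0≤ 1≤a) (1≤⇒≉0 1≤a)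
    ... | d , 0≤d , ad≈1 = x≤d*y⇒c*x≤y (1≤⇒0≤ 1≤a) ad≈1
      (^ʳ≤ 1≤y λ m n w 1≤n m≤np 0≤w wⁿ≤yᵐ →
        c*x≤y⇒x≤d*y 0≤d ad≈1 (bound m n w 1≤n m≤np 0≤w wⁿ≤yᵐ))
      where
      0≤a = 1≤⇒0≤ 1≤a
      1≤ay = 1≤* 1≤a 1≤y
      bound : ∀ m n w → 1 ℕ.≤ n → m · 1# ≤ n · p → 0# ≤ w → w ^ n ≤ y ^ m → a * w ≤ (a * y) ^ʳ p
      bound m n w 1≤n m≤np 0≤w wⁿ≤yᵐ with ℕ.≤-total n m
      ... | inj₁ n≤m = ≤^ʳ m n 1≤ay 1≤n m≤np (*-nonNeg 0≤a 0≤w) (begin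
        (a * w) ^ n    ≈⟨ ^-distrib-* a w n ⟩
        a ^ n * w ^ n  ≤⟨ *-mono-≤ (^-nonNeg m 0≤a) (^-nonNeg n 0≤w) (^-monoʳ-≤ 1≤a n≤m) wⁿ≤yᵐ ⟩
        a ^ m * y ^ m  ≈⟨ ^-distrib-* a y m ⟨
        (a * y) ^ m    ∎)
      ... | inj₂ m≤n = ≤^ʳ 1 1 1≤ay (s≤s z≤n) (+-monoˡ-≤ 0# 1≤p) (*-nonNeg 0≤a 0≤w)
        (^-mono-≤ 1 (*-nonNeg 0≤a 0≤w) (*-monoˡ-≤ 0≤a
          (^-cancel-≤ n 1≤n 1≤y (≤-trans wⁿ≤yᵐ (^-monoʳ-≤ 1≤y m≤n)))))

    -- The constant is C = aᴺ with the natural N ≥ p: an exponent m/n ≤ p has m ≤ Nn, hence aᵐ ≤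
    -- (aᴺ)ⁿ. The inverse δ of C is the form used later, since it is δ that multiplies the
    -- coefficients of a simple function.
    ^ʳ-scale : ∀ {a} → 1# ≤ a → ∃[ δ ] ∃[ C ] 0# ≤ δ × 0# ≤ C × δ * C ≈ 1# ×
               (∀ {y} → 1# ≤ y → δ * (a * y) ^ʳ p ≤ y ^ʳ p)
    ^ʳ-scale {a} 1≤a with nonNegInverse (1≤⇒0≤ 1≤a) (1≤⇒≉0 1≤a)
    ... | d , 0≤d , ad≈1 = d ^ N , a ^ N , 0≤δ , 0≤C , δC≈1 , λ {y} 1≤y →
      x≤d*y⇒c*x≤y 0≤δ δC≈1 (^ʳ≤ (1≤* 1≤a 1≤y) λ m n w 1≤n m≤np 0≤w wⁿ≤ →
        c*x≤y⇒x≤d*y 0≤C δC≈1 (≤^ʳ m n 1≤y 1≤n m≤np (*-nonNeg 0≤δ 0≤w) (begin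
          (d ^ N * w) ^ n                    ≈⟨ ^-distrib-* (d ^ N) w n ⟩
          (d ^ N) ^ n * w ^ n                ≤⟨ *-monoˡ-≤ (^-nonNeg n 0≤δ) wⁿ≤ ⟩
          (d ^ N) ^ n * (a * y) ^ m          ≈⟨ *-cong (^-assocʳ d N n) (^-distrib-* a y m) ⟩
          d ^ (N ℕ.* n) * (a ^ m * y ^ m)    ≈⟨ *-assoc (d ^ (N ℕ.* n)) (a ^ m) (y ^ m) ⟨
          d ^ (N ℕ.* n) * a ^ m * y ^ m
            ≤⟨ *-monoʳ-≤ (^-nonNeg m (1≤⇒0≤ 1≤y))
                 (*-monoˡ-≤ (^-nonNeg (N ℕ.* n) 0≤d) (^-monoʳ-≤ 1≤a (exponent≤ {m} {n} m≤np))) ⟩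
          d ^ (N ℕ.* n) * a ^ (N ℕ.* n) * y ^ m
            ≈⟨ *-congʳ (inverse-^ (N ℕ.* n)) ⟩
          1# * y ^ m                         ≈⟨ *-identityˡ (y ^ m) ⟩
          y ^ m                              ∎)))
      where
      0≤δ = ^-nonNeg N 0≤d
      0≤C = ^-nonNeg N (1≤⇒0≤ 1≤a)
      inverse-^ : ∀ k → d ^ k * a ^ k ≈ 1#
      inverse-^ zero    = *-identityˡ 1#
      inverse-^ (suc k) = begin-equality
        d * d ^ k * (a * a ^ k)
          ≈⟨ Solver.solve 4 (λ d e a b → d :* e :* (a :* b) := a :* d :* (e :* b)) refl d (d ^ k) a (a ^ k) ⟩
        a * d * (d ^ k * a ^ k)    ≈⟨ *-cong ad≈1 (inverse-^ k) ⟩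
        1# * 1#                    ≈⟨ *-identityˡ 1# ⟩
        1#                         ∎
        where open Solver using (_:*_; _:=_)
      δC≈1 : d ^ N * a ^ N ≈ 1#
      δC≈1 = inverse-^ N

-- Integrability as a uniform bound on simple functions; measurability

module Integration (em : ∀ {ℓ} → ExcludedMiddle ℓ) (R : CompleteOrderedField) where

  open CompleteOrderedField R hiding (zero)
  open OrderedField R
  open Suprema em R
  open Analysis em R

  sup∞-finite⇒bounded : ∀ {ℓ} (S : Pred ℝ∞ ℓ) → IsFinite (sup∞ S) → ∃[ b ] UpperBound _≤∞_ S (fin b)
  sup∞-finite⇒bounded S finite with em {P = ∃[ b ] UpperBound _≤∞_ S (fin b)}
  ... | yes bounded = bounded
  ... | no _        = ⊥-elim finite

  sup∞-bounded⇒finite : ∀ {ℓ} (S : Pred ℝ∞ ℓ) {b} → UpperBound _≤∞_ S (fin b) → IsFinite (sup∞ S)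
  sup∞-bounded⇒finite S {b} S≤b with em {P = ∃[ b ] UpperBound _≤∞_ S (fin b)}
  ... | yes _      = _
  ... | no ¬bounded = ¬bounded (b , S≤b)

  ≤∞-trans : ∀ {x y z} → x ≤∞ y → y ≤∞ z → x ≤∞ z
  ≤∞-trans {fin _} {fin _} {fin _} x≤y y≤z = ≤-trans x≤y y≤z
  ≤∞-trans {fin _} {_}     {∞}     _   _   = _
  ≤∞-trans {∞}     {_}     {∞}     _   _   = _
  ≤∞-trans {∞}     {∞}     {fin _} _   ()

  x≤x+∞0 : ∀ x → x ≤∞ x +∞ fin 0#
  x≤x+∞0 (fin x) = ≤-reflexive (sym (+-identityʳ x))
  x≤x+∞0 ∞       = _

  sum∞-fin : ∀ {n} {a : Fin n → ℝ∞} {b : Fin n → ℝ} → (∀ i → a i ≡ fin (b i)) → sum∞ a ≡ fin (sum b)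
  sum∞-fin {zero}  a≡b = ≡.refl
  sum∞-fin {suc n} a≡b = ≡.cong₂ _+∞_ (a≡b zero) (sum∞-fin (a≡b ∘ suc))

  -- With its converse below, this reduces integrability to a uniform bound on the integrals of
  -- simple functions; the value of `∫` never has to be computed.
  integralBound⇒∈𝓛 : ∀ {ι} (M : MeasureSpace ι) {p f b} → Measurable (MeasureSpace.𝓕 M) f →
    (∀ s → _Below_ M s (λ x → ∣ f x ∣ ^ʳ p) → SimpleFunction.integral s ≤∞ fin b) → f ∈ 𝓛 M p
  integralBound⇒∈𝓛 M f-meas bound =
    f-meas , sup∞-bounded⇒finite _ λ { _ (s , s-below , ≡.refl) → bound s s-below }

  ∈𝓛⇒integralBound : ∀ {ι} (M : MeasureSpace ι) {p f} → f ∈ 𝓛 M p →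
    ∃[ b ] (∀ s → _Below_ M s (λ x → ∣ f x ∣ ^ʳ p) → SimpleFunction.integral s ≤∞ fin b)
  ∈𝓛⇒integralBound M (_ , finite) with sup∞-finite⇒bounded _ finite
  ... | b , S≤b = b , λ s s-below → S≤b _ (s , s-below , ≡.refl)

  private
    ¬¬-elim : ∀ {ℓ} {P : Set ℓ} → ¬ ¬ P → P
    ¬¬-elim = decidable-stable em

  module SigmaAlgebraProperties {ι} {X : Set ι} {𝓕 : Family X} (isSigmaAlgebra : IsSigmaAlgebra 𝓕) where
    open IsSigmaAlgebra isSigmaAlgebra
      renaming (resp to resp-≐; whole to U-closed; complement to ∁-closed; union to ⋃-closed)

    ∅∈𝓕 : ∅ ∈ 𝓕
    ∅∈𝓕 = resp-≐ ((λ ¬u → ⊥-elim (¬u _)) , λ ()) (∁-closed U-closed)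

    ∩-closed : ∀ {A B} → A ∈ 𝓕 → B ∈ 𝓕 → A ∩ B ∈ 𝓕
    ∩-closed {A} {B} A∈𝓕 B∈𝓕 = resp-≐
      ((λ ¬C → ¬¬-elim (λ ¬a → ¬C (0 , ¬a)) , ¬¬-elim (λ ¬b → ¬C (1 , ¬b)))
      , λ { (a , b) (zero , ¬a) → ¬a a ; (a , b) (suc _ , ¬b) → ¬b b })
      (∁-closed (⋃-closed C C∈𝓕))
      where
      C : ℕ → Pred X 0ℓ
      C zero    = ∁ A
      C (suc _) = ∁ B
      C∈𝓕 : ∀ n → C n ∈ 𝓕
      C∈𝓕 zero    = ∁-closed A∈𝓕
      C∈𝓕 (suc _) = ∁-closed B∈𝓕

    const-measurable : ∀ c → Measurable 𝓕 (λ _ → c)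
    const-measurable c B _ with em {P = c ∈ B}
    ... | yes c∈B = resp-≐ ((λ _ → c∈B) , _) U-closed
    ... | no  c∉B = resp-≐ ((λ ()) , c∉B) ∅∈𝓕

    preimage : ∀ {Y : Set ι} (F : X → Y) → IsSigmaAlgebra (λ A → (F ⊢ A) ∈ 𝓕)
    preimage F = record
      { resp       = λ (A⊆B , B⊆A) → resp-≐ ((λ {x} → A⊆B {F x}) , (λ {x} → B⊆A {F x}))
      ; whole      = U-closed
      ; complement = ∁-closed
      ; union      = λ A → ⋃-closed (λ n → F ⊢ A n)
      }

    -- By `preimage`, the sets whose preimage under x ↦ (f i x)ᵢ is measurable form a σ-algebra; it
    -- contains the generators of `Cyl I`, hence all of it.
    ∘-measurable : ∀ {I : Set ι} {τ : (I → ℝ) → ℝ} {f : I → X → ℝ} → Measurable (Cyl I) τ →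
      (∀ i → Measurable 𝓕 (f i)) → Measurable 𝓕 (λ x → τ (λ i → f i x))
    ∘-measurable {f = f} τ-meas f-meas B B∈Borel =
      σ-smallest (preimage (λ x i → f i x))
        (λ (i , C , C∈Borel , A⊆C , C⊆A) → resp-≐
          ((λ {x} → C⊆A {λ i → f i x}) , (λ {x} → A⊆C {λ i → f i x})) (f-meas i C C∈Borel))
        (τ-meas B B∈Borel)

  x<y⇒0<y-x : ∀ {x y} → x < y → 0# < y - x
  x<y⇒0<y-x {x} {y} (x≤y , x≉y) =
    x+y≤z⇒x≤z-y (≤-trans (≤-reflexive (+-identityˡ x)) x≤y) ,
    λ 0≈y-x → x≉y (sym (x∙y⁻¹≈ε⇒x≈y y x (sym 0≈y-x)))

  ∣∣>-open : ∀ u → IsOpen (λ y → u < ∣ y ∣)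
  ∣∣>-open u x u<∣x∣ = ∣ x ∣ - u , x<y⇒0<y-x u<∣x∣ , λ y ∣y-x∣<ε → ≰⇒> λ ∣y∣≤u →
    <⇒≱ ∣y-x∣<ε (≤-trans
      (+-monoˡ-≤ (- u) (≤-trans (∣-∣-triangle′ x y) (≤-trans (+-monoˡ-≤ _ ∣y∣≤u) (≤-reflexive (+-comm u _)))))
      (≤-reflexive (x+y-y≈x _ u)))

  ∣∣<-open : ∀ u → IsOpen (λ y → ∣ y ∣ < u)
  ∣∣<-open u x ∣x∣<u = u - ∣ x ∣ , x<y⇒0<y-x ∣x∣<u , λ y ∣y-x∣<ε → ≰⇒> λ u≤∣y∣ →
    <⇒≱ ∣y-x∣<ε (≤-trans
      (+-monoˡ-≤ (- ∣ x ∣) (≤-trans u≤∣y∣ (≤-trans (∣-∣-triangle x y) (≤-reflexive (+-comm _ _)))))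
      (≤-reflexive (x+y-y≈x _ ∣ x ∣)))

  -- A nonempty such `V` is a ray [u, ∞) or (u, ∞), where u is its infimum, obtained as the supremum
  -- of its lower bounds. The preimage under the absolute value is then the complement of an open
  -- set or an open set. This gives measurability of sets described through tᵖ from monotonicity,
  -- without continuity of the power.
  ∣∣-upClosed-Borel : (V : Pred ℝ 0ℓ) → (∀ {x y} → x ∈ V → x ≤ y → y ∈ V) → (∀ {x} → x ∈ V → 0# ≤ x) →
                      (∣_∣ ⊢ V) ∈ Borel
  ∣∣-upClosed-Borel V up 0≤V with em {P = ∃ V}
  ... | no ¬v = resp ((λ ()) , λ {x} x∈V → ¬v (∣ x ∣ , x∈V)) ∅∈Borel
    where open SigmaAlgebraProperties (σ-isSigmaAlgebra _) renaming (∅∈𝓕 to ∅∈Borel)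
  ... | yes (v , v∈V) = split
    where
    lowerBounds : Pred ℝ 0ℓ
    lowerBounds l = ∀ z → z ∈ V → l ≤ z
    u = sup lowerBounds
    u≤V : ∀ z → z ∈ V → u ≤ z
    u≤V z z∈V = sup≤ lowerBounds (0≤V z∈V) (λ l l≤V → l≤V z z∈V)
    >u⇒∈V : ∀ {z} → u < z → z ∈ V
    >u⇒∈V {z} u<z with em {P = ∃[ y ] y ∈ V × y ≤ z}
    ... | yes (y , y∈V , y≤z) = up y∈V y≤z
    ... | no ¬y = ⊥-elim (<⇒≱ u<z (≤sup lowerBounds (λ l l≤V → l≤V v v∈V) z
      (λ y y∈V → ≰⇒≥ (λ y≤z → ¬y (y , y∈V , y≤z)))))
    split : (∣_∣ ⊢ V) ∈ Borel
    split with em {P = u ∈ V}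
    ... | yes u∈V = resp
      ((λ {x} x≮u → up u∈V (¬¬-elim (λ u≰x → x≮u (≰⇒> u≰x))))
      , λ {x} x∈V x<u → <⇒≱ x<u (u≤V _ x∈V))
      (complement (generator (lift (∣∣<-open u))))
    ... | no u∉V = resp
      ((λ {x} → >u⇒∈V) , λ {x} x∈V → ≰⇒> (λ x≤u → u∉V (up x∈V x≤u)))
      (generator (lift (∣∣>-open u)))

  -- Finite measures, and integrability under an affine bound

  module MeasureProperties {ι} (M : MeasureSpace ι) where
    open MeasureSpace M
    open IsSigmaAlgebra isSigmaAlgebra
      renaming (resp to resp-≐; whole to U-closed; complement to ∁-closed; union to ⋃-closed)
    open SigmaAlgebraProperties isSigmaAlgebra

    private
      -- `μ-union` speaks of sequences, so a union of two sets is padded with empty ones.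
      pair : Pred Ω 0ℓ → Pred Ω 0ℓ → ℕ → Pred Ω 0ℓ
      pair A B 0             = A
      pair A B 1             = B
      pair A B (suc (suc _)) = ∅

      pair∈𝓕 : ∀ {A B} → A ∈ 𝓕 → B ∈ 𝓕 → ∀ n → pair A B n ∈ 𝓕
      pair∈𝓕 A∈𝓕 B∈𝓕 0             = A∈𝓕
      pair∈𝓕 A∈𝓕 B∈𝓕 1             = B∈𝓕
      pair∈𝓕 A∈𝓕 B∈𝓕 (suc (suc _)) = ∅∈𝓕

      pair-disjoint : ∀ {A B} → A Disjoint B → ∀ {m n} → m ≢ n → pair A B m Disjoint pair A B n
      pair-disjoint A⊥B {0}           {0}           m≢n _       = m≢n ≡.refl
      pair-disjoint A⊥B {0}           {1}           m≢n (a , b) = A⊥B (a , b)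
      pair-disjoint A⊥B {1}           {0}           m≢n (b , a) = A⊥B (a , b)
      pair-disjoint A⊥B {1}           {1}           m≢n _       = m≢n ≡.refl
      pair-disjoint A⊥B {0}           {suc (suc _)} m≢n (_ , ())
      pair-disjoint A⊥B {1}           {suc (suc _)} m≢n (_ , ())
      pair-disjoint A⊥B {suc (suc _)} {_}           m≢n (() , _)

      pair-union : ∀ {A B} → A ∈ 𝓕 → B ∈ 𝓕 → A Disjoint B →
        IsSupremum _≤∞_ (λ s → ∃[ n ] s ≡ sum∞ {n} (λ k → μ (pair A B (toℕ k)))) (μ (⋃ ℕ (pair A B)))
      pair-union A∈𝓕 B∈𝓕 A⊥B = μ-union (pair _ _) (pair∈𝓕 A∈𝓕 B∈𝓕) (pair-disjoint A⊥B)

      ⋃pair∈𝓕 : ∀ {A B} → A ∈ 𝓕 → B ∈ 𝓕 → ⋃ ℕ (pair A B) ∈ 𝓕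
      ⋃pair∈𝓕 A∈𝓕 B∈𝓕 = ⋃-closed (pair _ _) (pair∈𝓕 A∈𝓕 B∈𝓕)

      ∖-disjoint : ∀ {A B : Pred Ω 0ℓ} → A Disjoint (B ∩ ∁ A)
      ∖-disjoint (a , _ , ¬a) = ¬a a

    -- The first partial sum of the disjoint sequence `A`, `B ∩ ∁ A`, ∅, ... is already at most the
    -- measure of its union, which is `B`.
    μ-mono : ∀ {A B} → A ∈ 𝓕 → B ∈ 𝓕 → A ⊆ B → μ A ≤∞ μ B
    μ-mono {A} {B} A∈𝓕 B∈𝓕 A⊆B =
      ≤∞-trans {μ A} {μ A +∞ fin 0#} {μ B} (x≤x+∞0 (μ A))
        (≤∞-trans {μ A +∞ fin 0#} {μ (⋃ ℕ (pair A (B ∩ ∁ A)))} {μ B}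
          (proj₁ (pair-union A∈𝓕 B∖A∈𝓕 (∖-disjoint {A} {B})) _ (1 , ≡.refl))
          (μ-cong (⋃pair∈𝓕 A∈𝓕 B∖A∈𝓕) (to , from)))
      where
      B∖A∈𝓕 = ∩-closed B∈𝓕 (∁-closed A∈𝓕)
      to : ⋃ ℕ (pair A (B ∩ ∁ A)) ⊆ B
      to (0 , a)             = A⊆B a
      to (1 , (b , _))       = b
      to (suc (suc _) , ())
      from : B ⊆ ⋃ ℕ (pair A (B ∩ ∁ A))
      from {x} b with em {P = x ∈ A}
      ... | yes a = 0 , a
      ... | no ¬a = 1 , b , ¬a

    module Finite (finite : FiniteMeasure M) where

      private
        toReal : ℝ∞ → ℝ
        toReal (fin x) = x
        toReal ∞       = 0#

        fin-toReal : ∀ {x y} → x ≤∞ y → IsFinite y → x ≡ fin (toReal x)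
        fin-toReal {fin _} {fin _} _ _ = ≡.refl

      mass : Pred Ω 0ℓ → ℝ
      mass A = toReal (μ A)

      μ≡mass : ∀ {A} → A ∈ 𝓕 → μ A ≡ fin (mass A)
      μ≡mass A∈𝓕 = fin-toReal (μ-mono A∈𝓕 U-closed _) finite

      mass-nonNeg : ∀ {A} → A ∈ 𝓕 → 0# ≤ mass A
      mass-nonNeg A∈𝓕 = ≡.subst (fin 0# ≤∞_) (μ≡mass A∈𝓕) (μ-nonNeg A∈𝓕)

      mass-mono : ∀ {A B} → A ∈ 𝓕 → B ∈ 𝓕 → A ⊆ B → mass A ≤ mass B
      mass-mono A∈𝓕 B∈𝓕 A⊆B = ≡.subst₂ _≤∞_ (μ≡mass A∈𝓕) (μ≡mass B∈𝓕) (μ-mono A∈𝓕 B∈𝓕 A⊆B)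

      mass-∅ : mass ∅ ≤ 0#
      mass-∅ = ≡.subst (_≤∞ fin 0#) (μ≡mass ∅∈𝓕) μ-∅

      mass-empty : ∀ {A} → A ∈ 𝓕 → A ⊆ ∅ → mass A ≤ 0#
      mass-empty A∈𝓕 A⊆∅ = ≤-trans (mass-mono A∈𝓕 ∅∈𝓕 A⊆∅) mass-∅

      mass-superadditive : ∀ {A B C} → A ∈ 𝓕 → B ∈ 𝓕 → C ∈ 𝓕 → A Disjoint B → A ⊆ C → B ⊆ C →
                           mass A + mass B ≤ mass C
      mass-superadditive {A} {B} {C} A∈𝓕 B∈𝓕 C∈𝓕 A⊥B A⊆C B⊆C = begin
        mass A + mass B           ≈⟨ +-congˡ (+-identityʳ (mass B)) ⟨
        mass A + (mass B + 0#)    ≤⟨ ≡.subst₂ _≤∞_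
                                       (≡.cong₂ (λ a b → a +∞ (b +∞ fin 0#)) (μ≡mass A∈𝓕) (μ≡mass B∈𝓕)) (μ≡mass ⋃∈𝓕)
                                       (proj₁ (pair-union A∈𝓕 B∈𝓕 A⊥B) _ (2 , ≡.refl)) ⟩
        mass (⋃ ℕ (pair A B))     ≤⟨ mass-mono ⋃∈𝓕 C∈𝓕 ⋃⊆C ⟩
        mass C                    ∎
        where
        ⋃∈𝓕 = ⋃pair∈𝓕 A∈𝓕 B∈𝓕
        ⋃⊆C : ⋃ ℕ (pair A B) ⊆ C
        ⋃⊆C (0 , a)            = A⊆C a
        ⋃⊆C (1 , b)            = B⊆C b
        ⋃⊆C (suc (suc _) , ())

      -- Where superadditivity uses that the measure of a union bounds the partial sums, this uses
      -- that it is the least bound: no partial sum for `A ∩ B`, `A ∩ ∁ B`, ∅, ... exceeds the sum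
      -- of the two masses.
      mass-∖ : ∀ {A B} → A ∈ 𝓕 → B ∈ 𝓕 → mass A ≤ mass B + mass (A ∩ ∁ B)
      mass-∖ {A} {B} A∈𝓕 B∈𝓕 = begin
        mass A                                   ≤⟨ mass-mono A∈𝓕 ⋃∈𝓕 A⊆⋃ ⟩
        mass (⋃ ℕ (pair (A ∩ B) (A ∩ ∁ B)))
          ≤⟨ ≡.subst (_≤∞ fin (mass (A ∩ B) + mass (A ∩ ∁ B))) (μ≡mass ⋃∈𝓕)
               (proj₂ (pair-union A∩B∈𝓕 A∖B∈𝓕 (λ { ((_ , b) , _ , ¬b) → ¬b b })) (fin _) bound) ⟩
        mass (A ∩ B) + mass (A ∩ ∁ B)            ≤⟨ +-monoˡ-≤ _ (mass-mono A∩B∈𝓕 B∈𝓕 proj₂) ⟩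
        mass B + mass (A ∩ ∁ B)                  ∎
        where
        A∩B∈𝓕 = ∩-closed A∈𝓕 B∈𝓕
        A∖B∈𝓕 = ∩-closed A∈𝓕 (∁-closed B∈𝓕)
        ⋃∈𝓕 = ⋃pair∈𝓕 A∩B∈𝓕 A∖B∈𝓕
        A⊆⋃ : A ⊆ ⋃ ℕ (pair (A ∩ B) (A ∩ ∁ B))
        A⊆⋃ {x} a with em {P = x ∈ B}
        ... | yes b = 0 , a , b
        ... | no ¬b = 1 , a , ¬b
        sum-∅ : ∀ n → sum {n} (λ _ → mass ∅) ≤ 0#
        sum-∅ zero    = ≤-refl
        sum-∅ (suc n) = ≤-trans (+-mono-≤ mass-∅ (sum-∅ n)) (≤-reflexive (+-identityˡ 0#))
        partial : ∀ n → sum {n} (λ k → mass (pair (A ∩ B) (A ∩ ∁ B) (toℕ k))) ≤ mass (A ∩ B) + mass (A ∩ ∁ B)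
        partial 0             = +-nonNeg (mass-nonNeg A∩B∈𝓕) (mass-nonNeg A∖B∈𝓕)
        partial 1             = +-monoʳ-≤ _ (mass-nonNeg A∖B∈𝓕)
        partial (suc (suc n)) = +-monoʳ-≤ _ (≤-trans (+-monoʳ-≤ _ (sum-∅ n)) (≤-reflexive (+-identityʳ _)))
        bound : ∀ s → ∃[ n ] s ≡ sum∞ {n} (λ k → μ (pair (A ∩ B) (A ∩ ∁ B) (toℕ k))) →
                s ≤∞ fin (mass (A ∩ B) + mass (A ∩ ∁ B))
        bound _ (n , ≡.refl) = ≡.subst (_≤∞ fin _)
          (≡.sym (sum∞-fin {n} (λ k → μ≡mass (pair∈𝓕 A∩B∈𝓕 A∖B∈𝓕 (toℕ k))))) (partial n)

      mass-subadditive : ∀ {n A} {E : Fin n → Pred Ω 0ℓ} → A ∈ 𝓕 → (∀ j → E j ∈ 𝓕) →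
                         (∀ x → x ∈ A → ∃[ j ] x ∈ E j) → mass A ≤ sum (λ j → mass (E j))
      mass-subadditive {zero}  A∈𝓕 E∈𝓕 A⊆E = mass-empty A∈𝓕 λ {x} a → ¬Fin0 (proj₁ (A⊆E x a))
      mass-subadditive {suc n} {A} {E} A∈𝓕 E∈𝓕 A⊆E = ≤-trans (mass-∖ A∈𝓕 (E∈𝓕 zero)) (+-monoʳ-≤ _
        (mass-subadditive (∩-closed A∈𝓕 (∁-closed (E∈𝓕 zero))) (E∈𝓕 ∘ suc) rest))
        where
        rest : ∀ x → x ∈ A ∩ ∁ (E zero) → ∃[ j ] x ∈ E (suc j)
        rest x (a , ¬e) with A⊆E x a
        ... | zero  , e = ⊥-elim (¬e e)
        ... | suc j , e = j , e

      sum-mass≤ : ∀ {n B} {A : Fin n → Pred Ω 0ℓ} → (∀ i → A i ∈ 𝓕) → B ∈ 𝓕 →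
                  (∀ {i j} → i ≢ j → A i Disjoint A j) → (∀ i → A i ⊆ B) → sum (λ i → mass (A i)) ≤ mass B
      sum-mass≤ {zero}          A∈𝓕 B∈𝓕 A⊥A A⊆B = mass-nonNeg B∈𝓕
      sum-mass≤ {suc n} {B} {A} A∈𝓕 B∈𝓕 A⊥A A⊆B = ≤-trans
        (+-monoʳ-≤ _ (sum-mass≤ (A∈𝓕 ∘ suc) B∖A∈𝓕 (λ i≢j → A⊥A (i≢j ∘ suc-injective))
          (λ i a → A⊆B (suc i) a , λ a₀ → A⊥A (λ ()) (a₀ , a))))
        (mass-superadditive (A∈𝓕 zero) B∖A∈𝓕 B∈𝓕 (∖-disjoint {A zero} {B}) (A⊆B zero) proj₁)
        where B∖A∈𝓕 = ∩-closed B∈𝓕 (∁-closed (A∈𝓕 zero))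

      integral≡ : (s : SimpleFunction M) → let open SimpleFunction s in
                  integral ≡ fin (sum (λ i → coeff i * mass (piece i)))
      integral≡ s = sum∞-fin (λ i → ≡.cong (coeff i *∞_) (μ≡mass (piece∈𝓕 i)))
        where open SimpleFunction s

      module _ {p : ℝ} (1≤p : 1# ≤ p) where
        open Power 1≤p

        const∈𝓛 : ∀ {c} → ∣ c ∣ ≤ 1# → (λ _ → c) ∈ 𝓛 M p
        const∈𝓛 {c} ∣c∣≤1 = integralBound⇒∈𝓛 M (const-measurable c) λ s s-below →
          ≡.subst (_≤∞ fin (mass U)) (≡.sym (integral≡ s)) (integral≤ s s-below)
          where
          module _ (s : SimpleFunction M) (s-below : _Below_ M s (λ _ → ∣ c ∣ ^ʳ p)) where
            open SimpleFunction s
            term≤ : ∀ i → coeff i * mass (piece i) ≤ mass (piece i)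
            term≤ i with em {P = ∃ (piece i)}
            ... | yes (x , x∈) = ≤-trans
              (*-monoʳ-≤ (mass-nonNeg (piece∈𝓕 i)) (≤-trans (s-below i x x∈) (^ʳ≤1 (∣x∣-nonNeg c) ∣c∣≤1)))
              (≤-reflexive (*-identityˡ _))
            -- On an empty piece `s-below` leaves the coefficient unrestricted, so the vanishing of
            -- the mass has to give the bound.
            ... | no ¬x = begin
              coeff i * mass (piece i)  ≤⟨ *-monoˡ-≤ (nonNeg i) (mass-empty (piece∈𝓕 i) (λ {x} x∈ → ¬x (x , x∈))) ⟩
              coeff i * 0#              ≈⟨ zeroʳ _ ⟩
              0#                        ≤⟨ mass-nonNeg (piece∈𝓕 i) ⟩
              mass (piece i)            ∎
            integral≤ : sum (λ i → coeff i * mass (piece i)) ≤ mass U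
            integral≤ = ≤-trans (sum-mono-≤ term≤) (sum-mass≤ piece∈𝓕 U-closed disjoint _)

        -- Each piece of a simple function below |h|ᵖ is covered by the sets on
        -- which one fixed |gⱼ|ᵖ dominates the (scaled) coefficient; the pieces
        -- cut down to the j-th of these form a simple function below |gⱼ|ᵖ.
        dominated∈𝓛 : ∀ {n a} {g : Fin n → Ω → ℝ} {h : Ω → ℝ} → 1# ≤ a → (∀ j → g j ∈ 𝓛 M p) →
          Measurable 𝓕 h → (∀ x → ∃[ j ] 1# ≤ ∣ g j x ∣ × ∣ h x ∣ ≤ a * ∣ g j x ∣) → h ∈ 𝓛 M p
        dominated∈𝓛 {n} {a} {g} {h} 1≤a g∈𝓛 h-meas dominated with ^ʳ-scale 1≤a
        ... | δ , C , 0≤δ , 0≤C , δC≈1 , scale = integralBound⇒∈𝓛 M h-meas λ s s-below →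
          ≡.subst (_≤∞ fin (C * sum b)) (≡.sym (integral≡ s))
            (c*x≤y⇒x≤d*y 0≤C δC≈1 (bound s s-below))
          where
          b : Fin n → ℝ
          b j = proj₁ (∈𝓛⇒integralBound M (g∈𝓛 j))
          module _ (s : SimpleFunction M) (s-below : _Below_ M s (λ x → ∣ h x ∣ ^ʳ p)) where
            open SimpleFunction s
            -- The condition `1# ≤ t` makes this set upward closed by `^ʳ-mono-≤`, which compares
            -- with bases at least 1; its preimage under the absolute value is then Borel.
            large : Fin size → Pred ℝ 0ℓ
            large i t = 1# ≤ t × δ * coeff i ≤ t ^ʳ p
            part : Fin n → Fin size → Pred Ω 0ℓ
            part j i = piece i ∩ (λ x → large i ∣ g j x ∣)
            part∈𝓕 : ∀ j i → part j i ∈ 𝓕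
            part∈𝓕 j i = ∩-closed (piece∈𝓕 i) (proj₁ (g∈𝓛 j) _ (∣∣-upClosed-Borel (large i)
              (λ (1≤x , δc≤) x≤y → ≤-trans 1≤x x≤y ,
                ≤-trans δc≤ (^ʳ-mono-≤ (1≤⇒0≤ 1≤x) (≤-trans 1≤x x≤y) x≤y))
              (1≤⇒0≤ ∘ proj₁)))
            cut : Fin n → SimpleFunction M
            cut j = record
              { size     = size
              ; coeff    = λ i → δ * coeff i
              ; nonNeg   = λ i → *-nonNeg 0≤δ (nonNeg i)
              ; piece    = part j
              ; piece∈𝓕  = part∈𝓕 j
              ; disjoint = λ i≢j ((x∈ , _) , (x∈′ , _)) → disjoint i≢j (x∈ , x∈′)
              }
            cut-bound : ∀ j → sum (λ i → δ * coeff i * mass (part j i)) ≤ b j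
            cut-bound j = ≡.subst (_≤∞ fin (b j)) (integral≡ (cut j))
              (proj₂ (∈𝓛⇒integralBound M (g∈𝓛 j)) (cut j) (λ i x (_ , _ , δc≤) → δc≤))
            cover : ∀ i x → x ∈ piece i → ∃[ j ] x ∈ part j i
            cover i x x∈ with dominated x
            ... | j , 1≤g , h≤ag = j , x∈ , 1≤g , (begin
              δ * coeff i                ≤⟨ *-monoˡ-≤ 0≤δ (s-below i x x∈) ⟩
              δ * ∣ h x ∣ ^ʳ p           ≤⟨ *-monoˡ-≤ 0≤δ (^ʳ-mono-≤ (∣x∣-nonNeg _) (1≤* 1≤a 1≤g) h≤ag) ⟩
              δ * (a * ∣ g j x ∣) ^ʳ p   ≤⟨ scale 1≤g ⟩
              ∣ g j x ∣ ^ʳ p             ∎)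
            bound : δ * sum (λ i → coeff i * mass (piece i)) ≤ sum b
            bound = begin
              δ * sum (λ i → coeff i * mass (piece i))
                ≈⟨ *-distribˡ-sum δ (λ i → coeff i * mass (piece i)) ⟩
              sum (λ i → δ * (coeff i * mass (piece i)))
                ≈⟨ sum-cong-≋ (λ i → sym (*-assoc δ (coeff i) (mass (piece i)))) ⟩
              sum (λ i → δ * coeff i * mass (piece i))
                ≤⟨ sum-mono-≤ (λ i → *-monoˡ-≤ (*-nonNeg 0≤δ (nonNeg i))
                     (mass-subadditive (piece∈𝓕 i) (λ j → part∈𝓕 j i) (cover i))) ⟩
              sum (λ i → δ * coeff i * sum (λ j → mass (part j i)))
                ≈⟨ sum-cong-≋ (λ i → *-distribˡ-sum (δ * coeff i) (λ j → mass (part j i))) ⟩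
              sum (λ i → sum (λ j → δ * coeff i * mass (part j i)))
                ≈⟨ ∑-comm (λ i j → δ * coeff i * mass (part j i)) ⟩
              sum (λ j → sum (λ i → δ * coeff i * mass (part j i)))
                ≤⟨ sum-mono-≤ cut-bound ⟩
              sum b
                ∎

        -- At each point an index attaining the maximum m of 1 and the |gⱼ| bounds the whole affine
        -- expression by (k + Σ λⱼ) m. The further 1 in the factor makes it at least 1, as
        -- `dominated∈𝓛` requires.
        affineBound∈𝓛 : ∀ {n k} {coef : Fin n → ℝ} {g : Fin n → Ω → ℝ} {h : Ω → ℝ} →
          0# ≤ k → (∀ j → 0# ≤ coef j) → (∀ j → g j ∈ 𝓛 M p) → Measurable 𝓕 h →
          (∀ x → ∣ h x ∣ ≤ k + sum (λ j → coef j * ∣ g j x ∣)) → h ∈ 𝓛 M p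
        affineBound∈𝓛 {n} {k} {coef} {g} {h} 0≤k 0≤coef g∈𝓛 h-meas h≤ =
          dominated∈𝓛 (x≤x+y (+-nonNeg 0≤k (sum-nonNeg 0≤coef))) g′∈𝓛 h-meas dominated
          where
          g′ : Fin (suc n) → Ω → ℝ
          g′ zero    _ = 1#
          g′ (suc j)   = g j
          g′∈𝓛 : ∀ j → g′ j ∈ 𝓛 M p
          g′∈𝓛 zero    = const∈𝓛 (∣x∣≤ ≤-refl (≤-trans (x≤y+x 0≤1) (≤-trans (≤-reflexive (-‿inverseʳ 1#)) 0≤1)))
          g′∈𝓛 (suc j) = g∈𝓛 j
          dominated : ∀ x → ∃[ j ] 1# ≤ ∣ g′ j x ∣ × ∣ h x ∣ ≤ (1# + (k + sum coef)) * ∣ g′ j x ∣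
          dominated x with maximum (λ j → ∣ g′ j x ∣)
          ... | j , max = j , 1≤m , (begin
            ∣ h x ∣                                 ≤⟨ h≤ x ⟩
            k + sum (λ j → coef j * ∣ g j x ∣)      ≤⟨ +-mono-≤ (x≤x*y 0≤k 1≤m)
                                                         (sum-mono-≤ (λ i → *-monoˡ-≤ (0≤coef i) (max (suc i)))) ⟩
            k * m + sum (λ j → coef j * m)          ≈⟨ +-congˡ (*-distribʳ-sum m coef) ⟨
            k * m + sum coef * m                    ≈⟨ distribʳ m k (sum coef) ⟨
            (k + sum coef) * m                      ≤⟨ *-monoʳ-≤ (1≤⇒0≤ 1≤m) (x≤y+x 0≤1) ⟩
            (1# + (k + sum coef)) * m               ∎)
            where
            m = ∣ g′ j x ∣
            1≤m : 1# ≤ m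
            1≤m = ≤-trans (x≤∣x∣ 1#) (max zero)

  -- Indicators, and measures on ℕ with summable weights

  χ : Set → ℝ
  χ P with em {P = P}
  ... | yes _ = 1#
  ... | no  _ = 0#

  χ-nonNeg : ∀ P → 0# ≤ χ P
  χ-nonNeg P with em {P = P}
  ... | yes _ = 0≤1
  ... | no  _ = ≤-refl

  χ≤1 : ∀ P → χ P ≤ 1#
  χ≤1 P with em {P = P}
  ... | yes _ = ≤-refl
  ... | no  _ = 0≤1

  1≤χ : ∀ {P} → P → 1# ≤ χ P
  1≤χ {P} p with em {P = P}
  ... | yes _ = ≤-refl
  ... | no ¬p = ⊥-elim (¬p p)

  χ-false : ∀ {P} → ¬ P → χ P ≈ 0#
  χ-false {P} ¬p with em {P = P}
  ... | yes p = ⊥-elim (¬p p)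
  ... | no _  = refl

  χ-mono : ∀ {P Q} → (P → Q) → χ P ≤ χ Q
  χ-mono {P} {Q} f with em {P = P}
  ... | yes p = 1≤χ (f p)
  ... | no _  = χ-nonNeg Q

  sum-χ≤ : ∀ {k b} {c : Fin k → ℝ} {P : Fin k → Set} → (∀ i → 0# ≤ c i) →
    (∀ {i j} → i ≢ j → P i → ¬ P j) → 0# ≤ b → (∀ i → P i → c i ≤ b) → sum (λ i → c i * χ (P i)) ≤ b
  sum-χ≤ {zero}              0≤c P⊥P 0≤b c≤b = 0≤b
  sum-χ≤ {suc k} {b} {c} {P} 0≤c P⊥P 0≤b c≤b with em {P = P zero}
  ... | no _ = begin
    c zero * 0# + sum (λ i → c (suc i) * χ (P (suc i)))
      ≈⟨ trans (+-congʳ (zeroʳ (c zero))) (+-identityˡ _) ⟩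
    sum (λ i → c (suc i) * χ (P (suc i)))
      ≤⟨ sum-χ≤ (0≤c ∘ suc) (λ i≢j → P⊥P (i≢j ∘ suc-injective)) 0≤b (c≤b ∘ suc) ⟩
    b
      ∎
  ... | yes p = begin
    c zero * 1# + sum (λ i → c (suc i) * χ (P (suc i)))
      ≈⟨ +-cong (*-identityʳ (c zero)) (sum-cong-≋ (λ i →
           trans (*-congˡ (χ-false (P⊥P (λ ()) p))) (zeroʳ (c (suc i))))) ⟩
    c zero + sum {k} (λ _ → 0#)
      ≈⟨ trans (+-congˡ (sum-replicate-zero k)) (+-identityʳ (c zero)) ⟩
    c zero
      ≤⟨ c≤b zero p ⟩
    b
      ∎

  module Discrete (ι : Level) {w : ℕ → ℝ} (0≤w : ∀ n → 0# ≤ w n)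
                  {W : ℝ} (∑w≤W : ∀ N → partialSum w N ≤ W) where

    private
      -- The preservation hypothesis ranges over measure spaces at level `ι`, so ℕ is moved there.
      Ω = Lift ι ℕ

      partialMass : Pred Ω 0ℓ → ℕ → ℝ
      partialMass A = partialSum (λ n → χ (A (lift n)) * w n)

    mass : Pred Ω 0ℓ → ℝ
    mass A = sup (λ y → ∃[ N ] y ≈ partialMass A N)

    private
      χw-nonNeg : ∀ (A : Pred Ω 0ℓ) n → 0# ≤ χ (A (lift n)) * w n
      χw-nonNeg A n = *-nonNeg (χ-nonNeg (A (lift n))) (0≤w n)

      partialMass≤mass : ∀ A N → partialMass A N ≤ mass A
      partialMass≤mass A N = ≤sup _ bound _ (N , refl)
        where
        bound : ∀ y → ∃[ N ] y ≈ partialMass A N → y ≤ W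
        bound y (N , y≈) = begin
          y                             ≈⟨ y≈ ⟩
          partialMass A N               ≤⟨ partialSum-mono-≤ N (λ n _ → *-monoʳ-≤ (0≤w n) (χ≤1 (A (lift n)))) ⟩
          partialSum (λ n → 1# * w n) N ≤⟨ partialSum-mono-≤ N (λ n _ → ≤-reflexive (*-identityˡ (w n))) ⟩
          partialSum w N                ≤⟨ ∑w≤W N ⟩
          W                             ∎

      mass≤ : ∀ {A b} → (∀ N → partialMass A N ≤ b) → mass A ≤ b
      mass≤ A≤b = sup≤ _ (A≤b 0) (λ { y (N , y≈) → ≤-trans (≤-reflexive y≈) (A≤b N) })

      mass-nonNeg : ∀ A → 0# ≤ mass A
      mass-nonNeg A = partialMass≤mass A 0

      -- A positive constant passes through the supremum by division; for `c` equal to 0 the bound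
      -- at `N` equal to 0 suffices.
      *-mass≤ : ∀ {A b c} → 0# ≤ c → (∀ N → c * partialMass A N ≤ b) → c * mass A ≤ b
      *-mass≤ {A} {b} {c} 0≤c cA≤b with em {P = c ≈ 0#}
      ... | yes c≈0 = begin
        c * mass A          ≈⟨ trans (*-congʳ c≈0) (zeroˡ _) ⟩
        0#                  ≈⟨ zeroʳ c ⟨
        c * 0#              ≤⟨ cA≤b 0 ⟩
        b                   ∎
      ... | no c≉0 with nonNegInverse 0≤c c≉0
      ... | d , 0≤d , cd≈1 = x≤d*y⇒c*x≤y 0≤c cd≈1 (mass≤ (λ N → c*x≤y⇒x≤d*y 0≤d cd≈1 (cA≤b N)))

      -- The limits N → ∞ of the summands are taken one at a time; e collects
      -- the summands whose limit is still to be taken.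
      sum-limit : ∀ {k B} {c : Fin k → ℝ} {A : Fin k → Pred Ω 0ℓ} (e : ℕ → ℝ) → (∀ i → 0# ≤ c i) →
        (∀ {m n} → m ℕ.≤ n → e m ≤ e n) →
        (∀ N → e N + sum (λ i → c i * partialMass (A i) N) ≤ B) →
        ∀ N → e N + sum (λ i → c i * mass (A i)) ≤ B
      sum-limit {zero}                  e 0≤c e-mono bound N = bound N
      sum-limit {suc k} {B} {c} {A} e 0≤c e-mono bound N = begin
        e N + (c zero * mass (A zero) + t)
          ≈⟨ Solver.solve 3 (λ x y z → x :+ (y :+ z) := y :+ (x :+ z)) refl (e N) _ t ⟩
        c zero * mass (A zero) + (e N + t)  ≤⟨ x≤z-y⇒x+y≤z (*-mass≤ (0≤c zero) (λ M → x+y≤z⇒x≤z-y (later M))) ⟩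
        B                                   ∎
        where
        open Solver using (_:+_; _:=_)
        t = sum (λ i → c (suc i) * mass (A (suc i)))
        A₀-mono : ∀ {m n} → m ℕ.≤ n → c zero * partialMass (A zero) m ≤ c zero * partialMass (A zero) n
        A₀-mono m≤n = *-monoˡ-≤ (0≤c zero) (partialSum-mono-index (χw-nonNeg (A zero)) m≤n)
        tail-limit : ∀ N → e N + c zero * partialMass (A zero) N + t ≤ B
        tail-limit = sum-limit (λ N → e N + c zero * partialMass (A zero) N) (0≤c ∘ suc)
          (λ m≤n → +-mono-≤ (e-mono m≤n) (A₀-mono m≤n))
          (λ N → ≤-trans (≤-reflexive (+-assoc _ _ _)) (bound N))
        later : ∀ M → c zero * partialMass (A zero) M + (e N + t) ≤ B
        later M = begin
          c zero * partialMass (A zero) M + (e N + t)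
            ≈⟨ Solver.solve 3 (λ x y z → x :+ (y :+ z) := y :+ x :+ z) refl _ (e N) t ⟩
          e N + c zero * partialMass (A zero) M + t
            ≤⟨ +-monoˡ-≤ t (+-mono-≤ (e-mono (ℕ.m≤m⊔n N M)) (A₀-mono (ℕ.m≤n⊔m N M))) ⟩
          e (N ℕ.⊔ M) + c zero * partialMass (A zero) (N ℕ.⊔ M) + t
            ≤⟨ tail-limit (N ℕ.⊔ M) ⟩
          B
            ∎

    -- At a finite stage the two sums can be exchanged, and by disjointness at most one coefficient
    -- counts at each point; `sum-limit` then passes to the masses. It serves twice: with `h` a
    -- power |g|ᵖ it bounds integrals, and with `h` an indicator it gives one half of countable
    -- additivity.
    sum-mass≤ : ∀ {k B} {c : Fin k → ℝ} {A : Fin k → Pred Ω 0ℓ} {h : ℕ → ℝ} →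
      (∀ i → 0# ≤ c i) → (∀ {i j} → i ≢ j → A i Disjoint A j) →
      (∀ n → 0# ≤ h n) → (∀ i n → lift n ∈ A i → c i ≤ h n) →
      (∀ N → partialSum (λ n → h n * w n) N ≤ B) → sum (λ i → c i * mass (A i)) ≤ B
    sum-mass≤ {k} {B} {c} {A} {h} 0≤c A⊥A 0≤h c≤h h≤B = begin
      sum (λ i → c i * mass (A i))       ≈⟨ +-identityˡ _ ⟨
      0# + sum (λ i → c i * mass (A i))  ≤⟨ sum-limit (λ _ → 0#) 0≤c (λ _ → ≤-refl) bound 0 ⟩
      B                                  ∎
      where
      pointwise : ∀ n → sum (λ i → c i * (χ (A i (lift n)) * w n)) ≤ h n * w n
      pointwise n = begin
        sum (λ i → c i * (χ (A i (lift n)) * w n))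
          ≈⟨ sum-cong-≋ (λ i → sym (*-assoc (c i) (χ (A i (lift n))) (w n))) ⟩
        sum (λ i → c i * χ (A i (lift n)) * w n)
          ≈⟨ *-distribʳ-sum (w n) (λ i → c i * χ (A i (lift n))) ⟨
        sum (λ i → c i * χ (A i (lift n))) * w n
          ≤⟨ *-monoʳ-≤ (0≤w n) (sum-χ≤ 0≤c (λ i≢j a b → A⊥A i≢j (a , b)) (0≤h n) (λ i → c≤h i n)) ⟩
        h n * w n
          ∎
      bound : ∀ N → 0# + sum (λ i → c i * partialMass (A i) N) ≤ B
      bound N = begin
        0# + sum (λ i → c i * partialMass (A i) N)
          ≈⟨ +-identityˡ _ ⟩
        sum (λ i → c i * partialMass (A i) N)
          ≈⟨ sum-cong-≋ (λ i → *-distribˡ-partialSum (c i) N) ⟩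
        sum (λ i → partialSum (λ n → c i * (χ (A i (lift n)) * w n)) N)
          ≈⟨ partialSum-sum (λ i n → c i * (χ (A i (lift n)) * w n)) N ⟨
        partialSum (λ n → sum (λ i → c i * (χ (A i (lift n)) * w n))) N
          ≤⟨ partialSum-mono-≤ N (λ n _ → pointwise n) ⟩
        partialSum (λ n → h n * w n) N
          ≤⟨ h≤B N ⟩
        B
          ∎

    weight≤mass : ∀ n → w n ≤ mass (λ x → Lift.lower x ≡ n)
    weight≤mass n = begin
      w n                            ≤⟨ y≤x*y (1≤χ ≡.refl) (0≤w n) ⟩
      χ (n ≡ n) * w n                ≤⟨ x≤y+x (partialSum-nonNeg (χw-nonNeg A) n) ⟩
      partialMass A (suc n)          ≤⟨ partialMass≤mass A (suc n) ⟩
      mass A                         ∎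
      where
      A : Pred Ω 0ℓ
      A x = Lift.lower x ≡ n

    private
      -- A partial mass sees only finitely many points, and those lying in the union already lie in
      -- finitely many of the sets; `reach` finds how many sets suffice.
      mass-⋃≤ : ∀ (A : ℕ → Pred Ω 0ℓ) {b} → (∀ K → sum {K} (λ k → mass (A (toℕ k))) ≤ b) → mass (⋃ ℕ A) ≤ b
      mass-⋃≤ A {b} A≤b = mass≤ bound
        where
        reach : ∀ N → ∃[ K ] (∀ n → n ℕ.< N → lift n ∈ ⋃ ℕ A → ∃[ k ] lift n ∈ A (toℕ {K} k))
        reach zero    = 0 , λ _ ()
        reach (suc N) with reach N | em {P = lift N ∈ ⋃ ℕ A}
        ... | K , hyp | no ¬a = K , λ n n<1+N a → hyp n (ℕ.≤∧≢⇒< (ℕ.s≤s⁻¹ n<1+N) (λ { ≡.refl → ¬a a })) a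
        ... | K , hyp | yes (k , a) = K ℕ.⊔ suc k , found
          where
          found : ∀ n → n ℕ.< suc N → lift n ∈ ⋃ ℕ A → ∃[ l ] lift n ∈ A (toℕ {K ℕ.⊔ suc k} l)
          found n n<1+N aₙ with n ℕ.≟ N
          ... | yes ≡.refl = fromℕ< (ℕ.m≤n⊔m K (suc k)) ,
            ≡.subst (λ m → lift n ∈ A m) (≡.sym (toℕ-fromℕ< (ℕ.m≤n⊔m K (suc k)))) a
          ... | no n≢N with hyp n (ℕ.≤∧≢⇒< (ℕ.s≤s⁻¹ n<1+N) n≢N) aₙ
          ... | l , a′ = inject≤ l (ℕ.m≤m⊔n K (suc k)) ,
            ≡.subst (λ m → lift n ∈ A m) (≡.sym (toℕ-inject≤ l (ℕ.m≤m⊔n K (suc k)))) a′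
        bound : ∀ N → partialMass (⋃ ℕ A) N ≤ b
        bound N with reach N
        ... | K , hyp = begin
          partialMass (⋃ ℕ A) N
            ≤⟨ partialSum-mono-≤ N pointwise ⟩
          partialSum (λ n → sum {K} (λ k → χ (A (toℕ k) (lift n)) * w n)) N
            ≈⟨ partialSum-sum {K} (λ k n → χ (A (toℕ k) (lift n)) * w n) N ⟩
          sum {K} (λ k → partialMass (A (toℕ k)) N)
            ≤⟨ sum-mono-≤ {K} (λ k → partialMass≤mass (A (toℕ k)) N) ⟩
          sum {K} (λ k → mass (A (toℕ k)))
            ≤⟨ A≤b K ⟩
          b
            ∎
          where
          pointwise : ∀ n → n ℕ.< N → χ (⋃ ℕ A (lift n)) * w n ≤ sum {K} (λ k → χ (A (toℕ k) (lift n)) * w n)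
          pointwise n n<N with em {P = lift n ∈ ⋃ ℕ A}
          ... | yes a with hyp n n<N a
          ... | k , aₖ = begin
            1# * w n                                      ≤⟨ *-monoʳ-≤ (0≤w n) (1≤χ aₖ) ⟩
            χ (A (toℕ k) (lift n)) * w n                  ≤⟨ term≤sum (λ l → χw-nonNeg (A (toℕ l)) n) k ⟩
            sum {K} (λ k → χ (A (toℕ k) (lift n)) * w n)  ∎
          pointwise n n<N | no _ =
            ≤-trans (≤-reflexive (zeroˡ (w n))) (sum-nonNeg {K} (λ l → χw-nonNeg (A (toℕ l)) n))

    measureSpace : MeasureSpace ι
    measureSpace = record
      { Ω              = Ω
      ; 𝓕              = λ _ → Lift _ ⊤
      ; isSigmaAlgebra = record { resp = λ _ _ → _ ; whole = _ ; complement = λ _ → _ ; union = λ _ _ → _ }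
      ; μ              = λ A → fin (mass A)
      ; μ-cong         = λ {A} {B} _ (A⊆B , _) → mass≤ (λ N → ≤-trans
          (partialSum-mono-≤ N (λ n _ → *-monoʳ-≤ (0≤w n) (χ-mono A⊆B))) (partialMass≤mass B N))
      ; μ-nonNeg       = λ {A} _ → mass-nonNeg A
      ; μ-∅            = mass≤ λ N → ≤-trans
          (partialSum-mono-≤ N (λ n _ → ≤-reflexive (trans (*-congʳ (χ-false (λ ()))) (zeroˡ (w n)))))
          (≤-reflexive (partialSum-zero N))
      ; μ-union        = λ A _ A⊥A →
          (λ { _ (K , ≡.refl) → ≡.subst (_≤∞ fin (mass (⋃ ℕ A))) (≡.sym (sum∞-fin {K} (λ _ → ≡.refl)))
            (≤-trans (sum-mono-≤ {K} (λ _ → ≤-reflexive (sym (*-identityˡ _))))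
              (sum-mass≤ {K} (λ _ → 0≤1) (λ i≢j → A⊥A (i≢j ∘ toℕ-injective)) (λ n → χ-nonNeg (⋃ ℕ A (lift n)))
                (λ k n a → 1≤χ (toℕ k , a)) (partialMass≤mass (⋃ ℕ A)))) })
          , λ { ∞ _ → _
              ; (fin b) A≤b → mass-⋃≤ A λ K → ≡.subst (_≤∞ fin b) (sum∞-fin {K} (λ _ → ≡.refl)) (A≤b _ (K , ≡.refl)) }
      }

    module _ {p : ℝ} (1≤p : 1# ≤ p) {g : ℕ → ℝ} where
      open Power 1≤p

      boundedSeries⇒∈𝓛 : ∀ {B} → (∀ N → partialSum (λ n → ∣ g n ∣ ^ʳ p * w n) N ≤ B) →
                         (g ∘ Lift.lower) ∈ 𝓛 measureSpace p
      boundedSeries⇒∈𝓛 {B} g≤B = integralBound⇒∈𝓛 measureSpace (λ _ _ → _) λ s s-below →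
        let open SimpleFunction s in
        ≡.subst (_≤∞ fin B) (≡.sym (sum∞-fin {size} (λ _ → ≡.refl)))
          (sum-mass≤ nonNeg disjoint (λ n → ^ʳ-nonNeg ∣ g n ∣) (λ k n → s-below k (lift n)) g≤B)

      ∈𝓛⇒boundedSeries : (g ∘ Lift.lower) ∈ 𝓛 measureSpace p →
                         ∃[ b ] (∀ K → sum {K} (λ k → ∣ g (toℕ k) ∣ ^ʳ p * w (toℕ k)) ≤ b)
      ∈𝓛⇒boundedSeries g∈𝓛 with ∈𝓛⇒integralBound measureSpace g∈𝓛
      ... | b , integral≤b = b , λ K → ≤-trans
        (sum-mono-≤ {K} (λ k → *-monoˡ-≤ (^ʳ-nonNeg ∣ g (toℕ k) ∣) (weight≤mass (toℕ k))))
        (≡.subst (_≤∞ fin b) (sum∞-fin {K} (λ _ → ≡.refl))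
          (integral≤b (atoms K) (λ { k (lift _) ≡.refl → ≤-refl })))
        where
        -- Singletons as pieces let the coefficients be the exact values of |g|ᵖ.
        atoms : ℕ → SimpleFunction measureSpace
        atoms K = record
          { size     = K
          ; coeff    = λ k → ∣ g (toℕ k) ∣ ^ʳ p
          ; nonNeg   = λ k → ^ʳ-nonNeg ∣ g (toℕ k) ∣
          ; piece    = λ k x → Lift.lower x ≡ toℕ k
          ; piece∈𝓕  = λ _ → _
          ; disjoint = λ k≢l (x≡k , x≡l) → k≢l (toℕ-injective (≡.trans (≡.sym x≡k) x≡l))
          }

  -- Cylinder sets depend on countably many coordinates

  -- Countable unions of countable sets, exhausted by squares: stage `n` collects all lists with
  -- both indices below `n`.
  merge : ∀ {a} {A : Set a} → (ℕ → ℕ → List A) → ℕ → List A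
  merge F n = concatMap (λ m → concatMap (F m) (upTo n)) (upTo n)

  ∈-merge⁺ : ∀ {a} {A : Set a} (F : ℕ → ℕ → List A) {x m n} → x ∈ₗ F m n → ∃[ k ] x ∈ₗ merge F k
  ∈-merge⁺ F {x} {m} {n} x∈ = suc (m ℕ.⊔ n) ,
    ∈-concatMap⁺ _ (lose (∈-upTo⁺ (s≤s (ℕ.m≤m⊔n m n))) (∈-concatMap⁺ (F m) (lose (∈-upTo⁺ (s≤s (ℕ.m≤n⊔m m n))) x∈)))

  -- A countable set of coordinates is coded by a sequence of finite lists rather than of points:
  -- this admits the empty set, also when I is empty, and each initial segment of lists is a finite
  -- set.
  DeterminedBy : ∀ {ι} {I : Set ι} → (ℕ → List I) → Pred (I → ℝ) 0ℓ → Set ι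
  DeterminedBy F A = ∀ v w → (∀ n i → i ∈ₗ F n → v i ≡ w i) → v ∈ A → w ∈ A

  -- Induction on the derivation of membership in `Cyl I`. Since the coordinates are computed from
  -- the derivation, the union case already has a family `F` to merge and makes no choice.
  Cyl-determined : ∀ {ι} {I : Set ι} {A : Pred (I → ℝ) 0ℓ} → A ∈ Cyl I → ∃[ F ] DeterminedBy F A
  Cyl-determined (generator (i , B , _ , A⊆ , ⊆A)) =
    (λ _ → i ∷ []) , λ v w v≡w v∈A → ⊆A (≡.subst B (v≡w 0 i (here ≡.refl)) (A⊆ v∈A))
  Cyl-determined (resp (A⊆B , B⊆A) A∈Cyl) with Cyl-determined A∈Cyl
  ... | F , det = F , λ v w v≡w v∈B → A⊆B (det v w v≡w (B⊆A v∈B))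
  Cyl-determined whole = (λ _ → []) , _
  Cyl-determined (complement A∈Cyl) with Cyl-determined A∈Cyl
  ... | F , det = F , λ v w v≡w v∉A w∈A → v∉A (det w v (λ n i i∈ → ≡.sym (v≡w n i i∈)) w∈A)
  Cyl-determined (union A A∈Cyl) = merge F , λ v w v≡w (m , v∈A) →
    m , proj₂ (Cyl-determined (A∈Cyl m)) v w (λ n i i∈ →
      let k , i∈k = ∈-merge⁺ F {m = m} i∈ in v≡w k i i∈k) v∈A
    where
    F : ℕ → ℕ → List _
    F m = proj₁ (Cyl-determined (A∈Cyl m))

  -- Preservation of integrability forces measurability and an affine bound

  module Necessity {ι} {I : Set ι} (τ : (I → ℝ) → ℝ) {p : ℝ} (1≤p : 1# ≤ p)
    (preserves : (M : MeasureSpace ι) → FiniteMeasure M → PreservesIntegrability M p τ) where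

    open Power 1≤p

    private
      nullSpace : MeasureSpace ι
      nullSpace = record
        { Ω              = I → ℝ
        ; 𝓕              = Cyl I
        ; isSigmaAlgebra = σ-isSigmaAlgebra _
        ; μ              = λ _ → fin 0#
        ; μ-cong         = λ _ _ → ≤-refl
        ; μ-nonNeg       = λ _ → ≤-refl
        ; μ-∅            = ≤-refl
        ; μ-union        = λ _ _ _ →
            (λ { _ (n , ≡.refl) → ≡.subst (_≤∞ fin 0#) (≡.sym (sum∞-fin {n} (λ _ → ≡.refl)))
              (≤-reflexive (sum-replicate-zero n)) })
            , λ b 0≤b → 0≤b _ (0 , ≡.refl)
        }

    τ-measurable : Measurable (Cyl I) τ
    τ-measurable = proj₁ (preserves nullSpace _ (λ i v → v i) λ i → integralBound⇒∈𝓛 nullSpace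
      (λ B B∈Borel → generator (i , B , B∈Borel , id , id))
      (λ s _ → let open SimpleFunction s in
        ≡.subst (_≤∞ fin 0#) (≡.sym (sum∞-fin {size} (λ _ → ≡.refl)))
          (≤-reflexive (trans (sum-cong-≋ (λ i → zeroʳ (coeff i))) (sum-replicate-zero size)))))

    -- The bound by `S` is asked of each coordinate only from its own index on, which is all that
    -- treating finitely many coordinates per step can provide. If every point contributes at least
    -- 1, then K ≥ 1 + b points exceed any bound b on the integral.
    no-escape : (v : ℕ → I → ℝ) (S : ℕ → ℝ) → (∀ n → 1# ≤ S n) →
      (∀ i → ∃[ N ] (∀ n → N ℕ.≤ n → ∣ v n i ∣ ≤ S n)) →
      ¬ (∀ n → (1# + 1#) ^ suc n * S n ≤ ∣ τ (v n) ∣)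
    no-escape v S 1≤S v≤S S≤τ = 1≰0 (+-cancelʳ-≤ b (begin
      1# + b                                              ≤⟨ proj₂ (archimedean (1# + b)) ⟩
      K · 1#                                              ≤⟨ n·1≤sum {K} (λ k → 1≤τw (toℕ k)) ⟩
      sum {K} (λ k → ∣ τ (v (toℕ k)) ∣ ^ʳ p * w (toℕ k))  ≤⟨ proj₂ τ-bound K ⟩
      b                                                   ≈⟨ +-identityˡ b ⟨
      0# + b                                              ∎))
      where
      0≤2 = +-nonNeg 0≤1 0≤1
      1≤2 : 1# ≤ 1# + 1#
      1≤2 = x≤x+y 0≤1
      half = nonNegInverse 0≤2 (1≤⇒≉0 1≤2)
      ½ = proj₁ half
      0≤½ = proj₁ (proj₂ half)
      2½≈1 = proj₂ (proj₂ half)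
      ½+½≈1 : ½ + ½ ≈ 1#
      ½+½≈1 = trans (+-cong (sym (*-identityˡ ½)) (sym (*-identityˡ ½))) (trans (sym (distribʳ ½ 1# 1#)) 2½≈1)
      Sᵖ⁻¹ : ∀ n → ∃[ y ] 0# ≤ y × S n ^ʳ p * y ≈ 1#
      Sᵖ⁻¹ n = nonNegInverse (1≤⇒0≤ (1≤^ʳ (1≤S n))) (1≤⇒≉0 (1≤^ʳ (1≤S n)))
      w : ℕ → ℝ
      w n = ½ ^ suc n * proj₁ (Sᵖ⁻¹ n)
      0≤w : ∀ n → 0# ≤ w n
      0≤w n = *-nonNeg (^-nonNeg (suc n) 0≤½) (proj₁ (proj₂ (Sᵖ⁻¹ n)))
      Sᵖw≈ : ∀ n → S n ^ʳ p * w n ≈ ½ ^ suc n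
      Sᵖw≈ n = begin-equality
        S n ^ʳ p * (½ ^ suc n * y)
          ≈⟨ Solver.solve 3 (λ x y z → x :* (y :* z) := y :* (x :* z)) refl (S n ^ʳ p) (½ ^ suc n) y ⟩
        ½ ^ suc n * (S n ^ʳ p * y)   ≈⟨ *-congˡ (proj₂ (proj₂ (Sᵖ⁻¹ n))) ⟩
        ½ ^ suc n * 1#               ≈⟨ *-identityʳ _ ⟩
        ½ ^ suc n                    ∎
        where
        open Solver using (_:*_; _:=_)
        y = proj₁ (Sᵖ⁻¹ n)
      -- Here `S n` being at least 1 keeps the total mass below a geometric series, so the measure
      -- is finite.
      w≤ : ∀ n → w n ≤ ½ ^ suc n
      w≤ n = ≤-trans (y≤x*y (1≤^ʳ (1≤S n)) (0≤w n)) (≤-reflexive (Sᵖw≈ n))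
      geometric : ∀ N → partialSum (λ n → ½ ^ suc n) N + ½ ^ N ≈ 1#
      geometric zero    = +-identityˡ 1#
      geometric (suc N) = begin-equality
        partialSum (λ n → ½ ^ suc n) N + ½ * ½ ^ N + ½ * ½ ^ N    ≈⟨ +-assoc _ _ _ ⟩
        partialSum (λ n → ½ ^ suc n) N + (½ * ½ ^ N + ½ * ½ ^ N)  ≈⟨ +-congˡ (distribʳ (½ ^ N) ½ ½) ⟨
        partialSum (λ n → ½ ^ suc n) N + (½ + ½) * ½ ^ N          ≈⟨ +-congˡ (trans (*-congʳ ½+½≈1) (*-identityˡ _)) ⟩
        partialSum (λ n → ½ ^ suc n) N + ½ ^ N                    ≈⟨ geometric N ⟩
        1#                                                        ∎
      geometric≤1 : ∀ N → partialSum (λ n → ½ ^ suc n) N ≤ 1#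
      geometric≤1 N = ≤-trans (x≤x+y (^-nonNeg N 0≤½)) (≤-reflexive (geometric N))
      open Discrete ι 0≤w (λ N → ≤-trans (partialSum-mono-≤ N (λ n _ → w≤ n)) (geometric≤1 N))
      f∈𝓛 : ∀ i → (λ x → v (Lift.lower x) i) ∈ 𝓛 measureSpace p
      f∈𝓛 i = boundedSeries⇒∈𝓛 1≤p {B = partialSum a N₀ + 1#} λ N →
        ≤-trans (partialSum-eventually-≤ 0≤a (λ n → ^-nonNeg (suc n) 0≤½) a≤ N) (+-monoʳ-≤ _ (geometric≤1 N))
        where
        N₀ = proj₁ (v≤S i)
        a : ℕ → ℝ
        a n = ∣ v n i ∣ ^ʳ p * w n
        0≤a : ∀ n → 0# ≤ a n
        0≤a n = *-nonNeg (^ʳ-nonNeg _) (0≤w n)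
        a≤ : ∀ n → N₀ ℕ.≤ n → a n ≤ ½ ^ suc n
        a≤ n N₀≤n = ≤-trans
          (*-monoʳ-≤ (0≤w n) (^ʳ-mono-≤ (∣x∣-nonNeg _) (1≤S n) (proj₂ (v≤S i) n N₀≤n)))
          (≤-reflexive (Sᵖw≈ n))
      τ-bound = ∈𝓛⇒boundedSeries 1≤p (preserves measureSpace _ (λ i x → v (Lift.lower x) i) f∈𝓛)
      b = proj₁ τ-bound
      K = proj₁ (archimedean (1# + b))
      -- The weight leaves a factor 2⁻ⁿ⁻¹; as p ≥ 1, the factor 2ⁿ⁺¹ does not shrink when raised to
      -- the power p and cancels it.
      1≤τw : ∀ n → 1# ≤ ∣ τ (v n) ∣ ^ʳ p * w n
      1≤τw n = begin
        1#                                       ≈⟨ 1^n≈1 (suc n) ⟨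
        1# ^ suc n                               ≈⟨ ^-congˡ (suc n) 2½≈1 ⟨
        ((1# + 1#) * ½) ^ suc n                  ≈⟨ ^-distrib-* (1# + 1#) ½ (suc n) ⟩
        (1# + 1#) ^ suc n * ½ ^ suc n            ≈⟨ *-congˡ (Sᵖw≈ n) ⟨
        (1# + 1#) ^ suc n * (S n ^ʳ p * w n)     ≈⟨ *-assoc _ (S n ^ʳ p) (w n) ⟨
        (1# + 1#) ^ suc n * S n ^ʳ p * w n       ≤⟨ *-monoʳ-≤ (0≤w n) (*^ʳ≤^ʳ (1≤^ (suc n) 1≤2) (1≤S n)) ⟩
        ((1# + 1#) ^ suc n * S n) ^ʳ p * w n     ≤⟨ *-monoʳ-≤ (0≤w n) (^ʳ-mono-≤ (1≤⇒0≤ 1≤2ⁿS)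
                                                      (≤-trans 1≤2ⁿS (S≤τ n)) (S≤τ n)) ⟩
        ∣ τ (v n) ∣ ^ʳ p * w n                   ∎
        where
        1≤2ⁿS = 1≤* (1≤^ (suc n) 1≤2) (1≤S n)
        1^n≈1 : ∀ k → 1# ^ k ≈ 1#
        1^n≈1 zero    = refl
        1^n≈1 (suc k) = trans (*-identityˡ _) (1^n≈1 k)

    AffinelyBounded : Set ι
    AffinelyBounded = ∃[ n ] Σ[ J ∈ (Fin n → I) ] Injective _≡_ _≡_ J ×
      (Σ[ coef ∈ (Fin n → ℝ) ] Σ[ k ∈ ℝ ]
        (∀ j → 0# ≤ coef j) × 0# ≤ k × (∀ v → ∣ τ v ∣ ≤ k + sum (λ j → coef j * ∣ v (J j) ∣)))

    private
      module Spike (¬bounded : ¬ AffinelyBounded) (relevant : I → Set ι)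
        (relevant-determine : ∀ k v w → (∀ i → relevant i → v i ≡ w i) → k · 1# < ∣ τ v ∣ → k · 1# < ∣ τ w ∣) where

        restrict : (I → ℝ) → I → ℝ
        restrict v i with em {P = relevant i}
        ... | yes _ = v i
        ... | no  _ = 0#

        restrict-relevant : ∀ v i → relevant i → v i ≡ restrict v i
        restrict-relevant v i r with em {P = relevant i}
        ... | yes _ = ≡.refl
        ... | no ¬r = ⊥-elim (¬r r)

        restrict-≤ : ∀ v i {S} → 0# ≤ S → (relevant i → ∣ v i ∣ ≤ S) → ∣ restrict v i ∣ ≤ S
        restrict-≤ v i 0≤S v≤S with em {P = relevant i}
        ... | yes r = v≤S r
        ... | no  _ = ∣x∣≤ 0≤S (≤-trans (≤-reflexive -0#≈0#) 0≤S)

        -- Failure of the affine bound with all constants equal to 1 + Λ gives |τ(v)| > (1 + Λ)S ≥ 1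
        -- + ΛS. A natural number l with ΛS ≤ l ≤ 1 + ΛS fits below |τ(v)|, and the set {|τ| > l}
        -- cannot tell v from its restriction to the relevant coordinates.
        spike : ∀ {Λ} → 1# ≤ Λ → (xs : List I) → Σ[ v ∈ (I → ℝ) ] Σ[ S ∈ ℝ ] 1# ≤ S ×
          (∀ i → (relevant i → i ∈ₗ xs) → ∣ v i ∣ ≤ S) × Λ * S ≤ ∣ τ v ∣
        spike {Λ} 1≤Λ xs with enumerate em xs
        ... | k , J , J-injective , J-covers =
          restrict v , S , 1≤S , v′≤S , ≤-trans (proj₁ (proj₂ level)) (proj₁ l<τv′)
          where
          0≤1+Λ = +-nonNeg 0≤1 (1≤⇒0≤ 1≤Λ)
          witness : Σ[ v ∈ (I → ℝ) ] ¬ (∣ τ v ∣ ≤ 1# + Λ + sum (λ j → (1# + Λ) * ∣ v (J j) ∣))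
          witness = ¬¬-elim λ none → ¬bounded
            (k , J , J-injective , (λ _ → 1# + Λ) , 1# + Λ , (λ _ → 0≤1+Λ) , 0≤1+Λ ,
              λ v → ¬¬-elim (λ τv≰ → none (v , τv≰)))
          v = proj₁ witness
          Σv = sum (λ j → ∣ v (J j) ∣)
          S = 1# + Σv
          1≤S : 1# ≤ S
          1≤S = x≤x+y (sum-nonNeg {k} (λ j → ∣x∣-nonNeg (v (J j))))
          level = ceiling (*-nonNeg (1≤⇒0≤ 1≤Λ) (1≤⇒0≤ 1≤S))
          l = proj₁ level
          l<τv : l · 1# < ∣ τ v ∣
          l<τv = ≰⇒> λ τv≤l → proj₂ witness (begin
            ∣ τ v ∣                                      ≤⟨ τv≤l ⟩
            l · 1#                                       ≤⟨ proj₂ (proj₂ level) ⟩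
            1# + Λ * S                                   ≤⟨ +-monoˡ-≤ _ 1≤S ⟩
            S + Λ * S                                    ≈⟨ +-congʳ (*-identityˡ S) ⟨
            1# * S + Λ * S                               ≈⟨ distribʳ S 1# Λ ⟨
            (1# + Λ) * S                                 ≈⟨ distribˡ (1# + Λ) 1# Σv ⟩
            (1# + Λ) * 1# + (1# + Λ) * Σv                ≈⟨ +-cong (*-identityʳ (1# + Λ))
                                                              (*-distribˡ-sum (1# + Λ) (λ j → ∣ v (J j) ∣)) ⟩
            1# + Λ + sum (λ j → (1# + Λ) * ∣ v (J j) ∣)  ∎)
          l<τv′ : l · 1# < ∣ τ (restrict v) ∣
          l<τv′ = relevant-determine l v (restrict v) (restrict-relevant v) l<τv
          covered≤S : ∀ i → ∃[ j ] J j ≡ i → ∣ v i ∣ ≤ S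
          covered≤S _ (j , ≡.refl) = ≤-trans (term≤sum {k} (λ j → ∣x∣-nonNeg (v (J j))) j) (x≤y+x 0≤1)
          v′≤S : ∀ i → (relevant i → i ∈ₗ xs) → ∣ restrict v i ∣ ≤ S
          v′≤S i i∈xs = restrict-≤ v i (1≤⇒0≤ 1≤S) (λ r → covered≤S i (J-covers i (i∈xs r)))

    affinelyBounded : AffinelyBounded
    affinelyBounded = ¬¬-elim λ ¬bounded →
      let open Spike ¬bounded relevant relevant-determine
          spikeₙ = λ n → spike (1≤2ⁿ n) (prefix n)
      in no-escape (λ n → proj₁ (spikeₙ n)) (λ n → proj₁ (proj₂ (spikeₙ n))) (λ n → proj₁ (proj₂ (proj₂ (spikeₙ n))))
        (λ i → let N , i∈prefix = eventually i in
          N , λ n N≤n → proj₁ (proj₂ (proj₂ (proj₂ (spikeₙ n)))) i (i∈prefix n N≤n))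
        (λ n → proj₂ (proj₂ (proj₂ (proj₂ (spikeₙ n)))))
      where
      1≤2ⁿ : ∀ n → 1# ≤ (1# + 1#) ^ suc n
      1≤2ⁿ n = 1≤^ (suc n) (x≤x+y 0≤1)
      -- Natural thresholds give countably many level sets, so that their determining coordinates
      -- can be merged into one countable set.
      exceeds : ℕ → Pred ℝ 0ℓ
      exceeds k y = k · 1# < ∣ y ∣
      determining : ∀ k → ∃[ F ] DeterminedBy F (τ ⊢ exceeds k)
      determining k = Cyl-determined (τ-measurable (exceeds k) (generator (lift (∣∣>-open (k · 1#)))))
      F : ℕ → List I
      F = merge (λ k → proj₁ (determining k))
      relevant : I → Set ι
      relevant i = ∃[ m ] i ∈ₗ F m
      relevant-determine : ∀ k v w → (∀ i → relevant i → v i ≡ w i) → k · 1# < ∣ τ v ∣ → k · 1# < ∣ τ w ∣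
      relevant-determine k v w v≡w = proj₂ (determining k) v w
        (λ m i i∈ → v≡w i (∈-merge⁺ (λ k → proj₁ (determining k)) {m = k} {n = m} i∈))
      prefix : ℕ → List I
      prefix n = concatMap F (upTo n)
      eventually : ∀ i → ∃[ N ] (∀ n → N ℕ.≤ n → relevant i → i ∈ₗ prefix n)
      eventually i with em {P = relevant i}
      ... | no ¬r = 0 , λ _ _ r → ⊥-elim (¬r r)
      -- `prefix n` contains `F m` only for m strictly below n.
      ... | yes (m , i∈) = suc m , λ n m<n _ → ∈-concatMap⁺ F (lose (∈-upTo⁺ m<n) i∈)

theorem2p2 : (em : ∀ {ℓ} → ExcludedMiddle ℓ) (R : CompleteOrderedField) →
    let open CompleteOrderedField R
        open Analysis em R
    in
    ∀ {ι} (I : Set ι) (τ : (I → ℝ) → ℝ) →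
    Congruent (λ v w → ∀ i → v i ≈ w i) _≈_ τ →
    (p : ℝ) → 1# ≤ p →
    ((M : MeasureSpace ι) → FiniteMeasure M → PreservesIntegrability M p τ)
    ⇔
    (Measurable (Cyl I) τ ×
     (∃[ n ] Σ[ J ∈ (Fin n → I) ] Injective _≡_ _≡_ J ×
      (Σ[ coef ∈ (Fin n → ℝ) ] Σ[ k ∈ ℝ ]
        (∀ j → 0# ≤ coef j) × 0# ≤ k ×
        (∀ v → ∣ τ v ∣ ≤ k + sum (λ j → coef j * ∣ v (J j) ∣)))))
theorem2p2 em R I τ _ p 1≤p = mk⇔
  (λ preserves → let open Necessity τ 1≤p preserves in τ-measurable , affinelyBounded)
  (λ { (τ-meas , n , J , _ , coef , k , 0≤coef , 0≤k , τ≤) M finite f f∈𝓛 →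
    let open MeasureProperties M
        open MeasureSpace M using (isSigmaAlgebra)
    in Finite.affineBound∈𝓛 finite 1≤p 0≤k 0≤coef (λ j → f∈𝓛 (J j))
      (SigmaAlgebraProperties.∘-measurable isSigmaAlgebra τ-meas (λ i → proj₁ (f∈𝓛 i)))
      (λ x → τ≤ (λ i → f i x)) })
  where
  open Analysis em R using (module MeasureSpace)
  open Integration em R
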